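{- There is a constant $c>0$ such that $\tau(d)\ge (cd)^{d/2}$ for all $d$ that are powers of $2$.
   Context: For an integer $d\ge1$, $\tau(d)$ denotes the largest integer $t$ for which there exist vectors $\mathbf{v}_1,\ldots,\mathbf{v}_t\in[-1,1]^d$ such that (i) $\mathbf{v}_1+\cdots+\mathbf{v}_t\in[-1,1]^d$, and (ii) for every $S\subset\{1,\ldots,t\}$ with $2\le|S|<t$, the sum $\sum_{i\in S}\mathbf{v}_i$ does not lie in $[-1,1]^d$. -}

module Defs where

open import Data.Nat as ℕ using (ℕ; zero; suc)
open import Data.Fin using (Fin; zero; suc)
open import Data.Fin.Subset using (Subset) renaming (∣_∣ to ∣_∣ₛ)
open import Data.Rational using (ℚ; 0ℚ; 1ℚ; _+_; _≤_; ∣_∣; _<_)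
open import Data.Product using (Σ; _×_; ∃)
open import Relation.Nullary using (¬_)
open import Relation.Nullary.Decidable using (does)
open import Data.Bool using (if_then_else_)
open import Data.Vec using (lookup)
open import Data.Bool using (true; false)

sumFin : (t : ℕ) → (Fin t → ℚ) → ℚ
sumFin zero    f = 0ℚ
sumFin (suc t) f = f zero + sumFin t (λ i → f (suc i))

InCube : (d : ℕ) → (Fin d → ℚ) → Set
InCube d x = (j : Fin d) → ∣ x j ∣ ≤ 1ℚ

subsetSum : {d t : ℕ} → (Fin t → Fin d → ℚ) → Subset t → Fin d → ℚ
subsetSum {d} {t} v S j = sumFin t (λ i → if lookup S i then v i j else 0ℚ)

totalSum : {d t : ℕ} → (Fin t → Fin d → ℚ) → Fin d → ℚ
totalSum {d} {t} v j = sumFin t (λ i → v i j)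

-- v_1,...,v_t ∈ [-1,1]^d witness the defining property of τ(d) for the value t
Witness : (d t : ℕ) → (Fin t → Fin d → ℚ) → Set
Witness d t v =
  ((i : Fin t) → InCube d (v i)) ×
  InCube d (totalSum v) ×
  ((S : Subset t) → 2 ℕ.≤ ∣ S ∣ₛ → ∣ S ∣ₛ ℕ.< t → ¬ InCube d (subsetSum v S))

-- t is an admissible value in the definition of τ(d)
Admissible : (d t : ℕ) → Set
Admissible d t = Σ (Fin t → Fin d → ℚ) (Witness d t)

{-# OPTIONS --safe #-}
module Submission where

-- Let n = 2^m and let χ_β be the characters of {0,1}^m.  Order the words of weight at least 5 as
-- binary numbers, and let α come right after p.  Some affine subspace U through α and p, with as many
-- dimensions as α has ones, consists otherwise of words that precede p or have weight below 5.  With P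
-- the annihilator of its direction, χ_p (1 - 2·1_P) takes the values ±1, and a z orthogonal to it
-- satisfies Σ_{β ∈ U} y_β = 2^(dim U - 1) y_p, where y is the transform of z.  If z is also orthogonal
-- to the characters of weight below 5, then y grows by a factor of about 2^(weight of α) from p to α, so
-- a nonzero integral z has ℓ¹-norm at least the product of these factors, (cn)^(n/2).  This is a variant
-- of the ill-conditioned sign matrices of Håstad and of Alon and Vŭ.
--
-- These are n - 1 sign rows, so an integral z ≠ 0 orthogonal to all of them exists.  Repeat column x
-- ∣z_x∣ times with the sign of z_x, and pass to a minimal nonempty zero-sum subfamily, of size t: it is
-- long.  A sum of signs in [-1,1] may be ±1 instead of 0.  To rule this out, add a second copy of the
-- constant row, change 1 to 1 - 1/t there, and change -1 to -1 + 1/t in all other rows.  If the sum of a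
-- proper subfamily with at least two members is in the cube, then it came from 0 in both copies, so the
-- size is even, and then it came from 0 in every row.

open import Defs
open import Data.Nat using (ℕ; zero; suc; pred; _+_; _*_; _^_; _∸_; _≤_; _<_; _≤ᵇ_; z≤n; s≤s; _≤?_; _<?_)
open import Data.Nat.Properties
open import Data.Nat.Induction using (<-wellFounded)
open import Induction.WellFounded using (Acc; acc)
open import Data.Integer as ℤ using (ℤ; +_; -[1+_]; ∣_∣; 0ℤ; 1ℤ; -1ℤ)
import Data.Integer.Properties as ℤ
open import Data.Rational as ℚ using (ℚ; 0ℚ; 1ℚ; toℚᵘ; fromℚᵘ)
import Data.Rational.Properties as ℚ
open import Data.Rational.Unnormalised as ℚᵘ using (mkℚᵘ; *≤*; *≡*)
import Data.Rational.Unnormalised.Properties as ℚᵘ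
open import Data.Bool using (Bool; true; false; if_then_else_)
open import Data.Bool.Properties using (T-≡)
open import Data.Vec as Vec using (Vec; []; _∷_; map; replicate)
open import Data.List as List using (List; []; _∷_; length; _++_)
open import Data.List.Properties using (length-++; length-replicate)
open import Data.Fin using (Fin; zero; suc; punchIn; punchOut; combine; remQuot)
open import Data.Fin.Properties as Fin using (any?; all?; punchIn-punchOut; remQuot-combine; combine-remQuot)
open import Data.Fin.Subset using (Subset) renaming (∣_∣ to ∣_∣ₛ)
open import Data.Fin.Subset.Properties using (anySubset?)
open import Data.Vec.Functional using (insertAt)
open import Data.Vec.Functional.Properties using (insertAt-lookup; insertAt-punchIn)
open import Algebra.Properties.Semiring.Sum ℤ.+-*-semiring
  using (sum; sum-remove; sum-cong-≗; ∑-distrib-+; *-distribʳ-sum; sum-replicate-zero)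
open import Data.Product using (Σ; ∃; _×_; _,_; proj₁; proj₂)
open import Data.Sum using (_⊎_; inj₁; inj₂)
open import Data.Unit using (⊤; tt)
open import Data.Empty using (⊥-elim)
open import Function using (_∘_)
open import Function.Bundles using (Equivalence)
open import Relation.Nullary using (¬_; yes; no; ¬?; _×-dec_)
open import Relation.Nullary.Decidable using (decidable-stable)
open import Relation.Unary using (Decidable)
open import Relation.Binary.PropositionalEquality
import Data.Nat.Tactic.RingSolver as ℕ-Ring
import Data.Integer.Tactic.RingSolver as ℤ-Ring

-- Characters, product functions and the chain of words

Word : ℕ → Set
Word = Vec Bool

ones : ∀ m → Word m
ones m = replicate m true

data Factor : Set where
  one sign ind : Factor

factor : Factor → Bool → ℤ
factor one  _     = 1ℤ
factor sign false = 1ℤ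
factor sign true  = -1ℤ
factor ind  false = 1ℤ
factor ind  true  = 0ℤ

eval : ∀ {m} → Vec Factor m → Word m → ℤ
eval []      []      = 1ℤ
eval (f ∷ φ) (b ∷ x) = factor f b ℤ.* eval φ x

χ : ∀ {m} → Word m → Word m → ℤ
χ []          []      = 1ℤ
χ (false ∷ β) (b ∷ x) = χ β x
χ (true  ∷ β) (b ∷ x) = factor sign b ℤ.* χ β x

-- 2 ^ (number of inds) times the pairing of eval φ with z, in terms of the transform Y of z: averaging
-- over the two characters of a coordinate gives the indicator of false.
dual : ∀ {m} → Vec Factor m → (Word m → ℤ) → ℤ
dual []         Y = Y []
dual (one  ∷ φ) Y = dual φ λ β → Y (false ∷ β)
dual (sign ∷ φ) Y = dual φ λ β → Y (true ∷ β)
dual (ind  ∷ φ) Y = dual φ λ β → Y (false ∷ β) ℤ.+ Y (true ∷ β)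

-- Per coordinate: the bits of a word α and of its predecessor p are (0,0), (1,1), (1,0), (0,1).
data Tag : Set where
  both0 both1 pivot mirror : Tag

-- The row of α is C - G - H, where C = χ_p, and G + H = 2·1_P χ_p is a multiple of the sum of the
-- characters of U: those in G agree with p at the pivot and mirror coordinates, those in H with α.
tagC tagG tagH : Tag → Factor
tagC both0  = one
tagC both1  = sign
tagC pivot  = one
tagC mirror = sign
tagG both0  = one
tagG both1  = ind
tagG pivot  = one
tagG mirror = sign
tagH both0  = one
tagH both1  = ind
tagH pivot  = sign
tagH mirror = one

frees : ∀ {m} → Vec Tag m → ℕ
frees []           = 0
frees (both1 ∷ ts) = suc (frees ts)
frees (_     ∷ ts) = frees ts

-- For the words of weight at least K in binary order: low words have smaller weight, the first word
-- has no predecessor yet (its tags await a pivot in front), later words have one.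
data Class (m : ℕ) : Set where
  low   : Class m
  first : Vec Tag m → Class m
  later : Vec Tag m → Class m

extend₀ : ∀ {m} → Class m → Class (suc m)
extend₀ low        = low
extend₀ (first ts) = first (mirror ∷ ts)
extend₀ (later ts) = later (both0 ∷ ts)

-- The flag tells whether some word starting with 0 is heavy enough. If so, the first word starting
-- with 1 comes right after 0 1...1, and its pivot is this coordinate; if not, it is the first word
-- overall.
extend₁ : ∀ {m} → Bool → Class m → Class (suc m)
extend₁ _     low        = low
extend₁ true  (first ts) = later (pivot ∷ ts)
extend₁ false (first ts) = first (both1 ∷ ts)
extend₁ _     (later ts) = later (both1 ∷ ts)

classify : ∀ {m} → ℕ → Word m → Class m
classify {zero}  zero    []          = first []
classify {zero}  (suc K) []          = low
classify {suc m} K       (false ∷ α) = extend₀ (classify K α)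
classify {suc m} K       (true  ∷ α) = extend₁ (K ≤ᵇ m) (classify (pred K) α)

-- K ≤ m, following the recursion of classify along the first word 0 … 0 1 … 1 of weight K.
data Fits : ℕ → ℕ → Set where
  done : Fits 0 0
  skip : ∀ {m K} → Fits m K → Fits (suc m) K
  full : ∀ {m} → Fits m m → Fits (suc m) (suc m)

firstWord : ∀ {m K} → Fits m K → Word m
firstWord done     = []
firstWord (skip p) = false ∷ firstWord p
firstWord (full p) = true ∷ firstWord p

firstTags : ∀ {m K} → Fits m K → Vec Tag m
firstTags done     = []
firstTags (skip p) = mirror ∷ firstTags p
firstTags (full p) = both1 ∷ firstTags p

frees-firstTags : ∀ {m K} (p : Fits m K) → frees (firstTags p) ≡ K
frees-firstTags done     = refl
frees-firstTags (skip p) = frees-firstTags p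
frees-firstTags (full p) = cong suc (frees-firstTags p)

fits⇒≤ : ∀ {m K} → Fits m K → K ≤ m
fits⇒≤ done     = z≤n
fits⇒≤ (skip p) = m≤n⇒m≤1+n (fits⇒≤ p)
fits⇒≤ (full p) = s≤s (fits⇒≤ p)

fits-self : ∀ m → Fits m m
fits-self zero    = done
fits-self (suc m) = full (fits-self m)

≤⇒fits : ∀ {m K} → K ≤ m → Fits m K
≤⇒fits {zero}  {zero}  z≤n = done
≤⇒fits {suc m} {K}     K≤ with m≤n⇒m<n∨m≡n K≤
... | inj₁ (s≤s K≤m) = skip (≤⇒fits K≤m)
... | inj₂ refl      = fits-self (suc m)

fits-pred : ∀ {m K} → Fits m K → Fits m (pred K)
fits-pred p = ≤⇒fits (≤-trans pred[n]≤n (fits⇒≤ p))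

≤ᵇ-true : ∀ {m K} → Fits m K → (K ≤ᵇ m) ≡ true
≤ᵇ-true p = Equivalence.to T-≡ (≤⇒≤ᵇ (fits⇒≤ p))

≤ᵇ-false : ∀ m → (suc m ≤ᵇ m) ≡ false
≤ᵇ-false m with suc m ≤ᵇ m in eq
... | false = refl
... | true  = ⊥-elim (1+n≰n (≤ᵇ⇒≤ (suc m) m (Equivalence.from T-≡ eq)))

classify-firstWord : ∀ {m K} (p : Fits m K) → classify K (firstWord p) ≡ first (firstTags p)
classify-firstWord done     = refl
classify-firstWord (skip p) rewrite classify-firstWord p = refl
classify-firstWord {suc m} (full p) rewrite ≤ᵇ-false m | classify-firstWord p = refl

classify-< : ∀ {m K} → m < K → (α : Word m) → classify K α ≡ low
classify-< {zero}  {suc K} _   []          = refl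
classify-< {suc m} {suc K} m<K (false ∷ α) rewrite classify-< (<-trans (n<1+n m) m<K) α = refl
classify-< {suc m} {suc K} (s≤s m<K) (true ∷ α) rewrite classify-< m<K α = refl

-- The relation Σ_{β ∈ U} y_β = 2 ^ (dim U - 1) y_p, with l = dim U - 1.
Link : ∀ {m} → ℕ → Vec Tag m → (C G H : Word m → ℤ) → Set
Link l ts C G H = + (2 ^ l) ℤ.* dual (map tagC ts) C ≡ dual (map tagG ts) G ℤ.+ dual (map tagH ts) H

-- The condition at `α` once a prefix with `j` ones has been removed. Where the predecessor shares
-- this prefix, C restricts to it, which gives `Y`, while G and H sum over all prefixes contained in
-- it, which gives `Z`.
Sat : ∀ {m} → ℕ → (Y Z : Word m → ℤ) → Word m → Class m → Set
Sat j Y Z α low        = Y α ≡ 0ℤ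
Sat j Y Z α (first ts) = ⊤
Sat j Y Z α (later ts) = Link (j + frees ts) ts Y Z Z

-- ∣ Z - Y ∣ ≤ (2 ^ l - 1) M, without truncated subtraction.
Near : ∀ {m} → ℕ → ℕ → (Z Y : Word m → ℤ) → Set
Near l M Z Y = ∀ β → ∣ Z β ℤ.- Y β ∣ + M ≤ 2 ^ l * M

BoundedOffOnes : ∀ {m} → ℕ → (Word m → ℤ) → Set
BoundedOffOnes {m} M Y = ∀ β → β ≡ ones m ⊎ ∣ Y β ∣ ≤ M

tail₁ : ∀ {m} {β : Word m} → true ∷ β ≡ true ∷ ones m → β ≡ ones m
tail₁ refl = refl

module _ {m : ℕ} (Y : Word (suc m) → ℤ) where
  half : Bool → Word m → ℤ
  half b β = Y (b ∷ β)

  halves : Word m → ℤ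
  halves β = Y (false ∷ β) ℤ.+ Y (true ∷ β)

offOnes₀ : ∀ {m M} (Y : Word (suc m) → ℤ) → BoundedOffOnes M Y → ∀ β → ∣ half Y false β ∣ ≤ M
offOnes₀ Y b β with b (false ∷ β)
... | inj₁ ()
... | inj₂ le = le

offOnes₁ : ∀ {m M} (Y : Word (suc m) → ℤ) → BoundedOffOnes M Y → BoundedOffOnes M (half Y true)
offOnes₁ Y b β with b (true ∷ β)
... | inj₁ eq = inj₁ (tail₁ eq)
... | inj₂ le = inj₂ le

-- The new difference consists of the two old ones and a value of `Y` on the half starting with 0,
-- and 2 (2^l - 1) M + M = (2^(l+1) - 1) M.
near-halves : ∀ {m} l M (Z Y : Word (suc m) → ℤ) → Near l M Z Y →
  (∀ β → ∣ half Y false β ∣ ≤ M) → Near (suc l) M (halves Z) (half Y true)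
near-halves l M Z Y near le β = begin
  ∣ z₀ ℤ.+ z₁ ℤ.- y₁ ∣ + M                          ≡⟨ cong (λ i → ∣ i ∣ + M) (split z₀ z₁ y₀ y₁) ⟩
  ∣ (z₀ ℤ.- y₀) ℤ.+ (z₁ ℤ.- y₁) ℤ.+ y₀ ∣ + M         ≤⟨ +-monoˡ-≤ M (ℤ.∣i+j∣≤∣i∣+∣j∣ ((z₀ ℤ.- y₀) ℤ.+ (z₁ ℤ.- y₁)) y₀) ⟩
  ∣ (z₀ ℤ.- y₀) ℤ.+ (z₁ ℤ.- y₁) ∣ + ∣ y₀ ∣ + M       ≤⟨ +-monoˡ-≤ M (+-mono-≤ (ℤ.∣i+j∣≤∣i∣+∣j∣ (z₀ ℤ.- y₀) (z₁ ℤ.- y₁)) (le β)) ⟩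
  ∣ z₀ ℤ.- y₀ ∣ + ∣ z₁ ℤ.- y₁ ∣ + M + M              ≡⟨ shuffle ∣ z₀ ℤ.- y₀ ∣ ∣ z₁ ℤ.- y₁ ∣ M ⟩
  (∣ z₀ ℤ.- y₀ ∣ + M) + (∣ z₁ ℤ.- y₁ ∣ + M)          ≤⟨ +-mono-≤ (near (false ∷ β)) (near (true ∷ β)) ⟩
  2 ^ l * M + 2 ^ l * M                              ≡⟨ double (2 ^ l) M ⟩
  2 * 2 ^ l * M                                      ∎
  where
  open ≤-Reasoning
  z₀ = Z (false ∷ β)
  z₁ = Z (true ∷ β)
  y₀ = Y (false ∷ β)
  y₁ = Y (true ∷ β)
  split : ∀ a b c d → a ℤ.+ b ℤ.- d ≡ (a ℤ.- c) ℤ.+ (b ℤ.- d) ℤ.+ c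
  split = ℤ-Ring.solve-∀
  shuffle : ∀ a b c → a + b + c + c ≡ (a + c) + (b + c)
  shuffle = ℕ-Ring.solve-∀
  double : ∀ a b → a * b + a * b ≡ 2 * a * b
  double = ℕ-Ring.solve-∀

-- Raising M to N adds N - M on the left and 2^l times as much on the right.
near-mono : ∀ {m} l {M N} {Z Y : Word m → ℤ} → M ≤ N → Near l M Z Y → Near l N Z Y
near-mono l {M} {N} {Z} {Y} M≤N near β = begin
  x + N                 ≡⟨ cong (_+_ x) (sym (m+[n∸m]≡n M≤N)) ⟩
  x + (M + (N ∸ M))     ≡⟨ sym (+-assoc x M (N ∸ M)) ⟩
  x + M + (N ∸ M)       ≤⟨ +-mono-≤ (near β) (m≤n*m (N ∸ M) (2 ^ l) {{m^n≢0 2 l}}) ⟩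
  2 ^ l * M + 2 ^ l * (N ∸ M) ≡⟨ sym (*-distribˡ-+ (2 ^ l) M (N ∸ M)) ⟩
  2 ^ l * (M + (N ∸ M)) ≡⟨ cong (2 ^ l *_) (m+[n∸m]≡n M≤N) ⟩
  2 ^ l * N             ∎
  where
  open ≤-Reasoning
  x = ∣ Z β ℤ.- Y β ∣

extend₀-low : ∀ {m} {c : Class m} → c ≡ low → extend₀ c ≡ low
extend₀-low refl = refl

extend₁-low : ∀ {m} b {c : Class m} → c ≡ low → extend₁ b c ≡ low
extend₁-low b refl = refl

-- With y_p = C (ones m), y_α = Y (firstWord p) and L = l + K, this says
-- ∣ (2^L - 1) y_p - y_α ∣ ≤ 2 (2^L - 1) M, where M bounds y at the other words of U.
entry : ∀ {m K} (p : Fits m K) l M (Y C G H : Word m → ℤ) →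
  Near l M G C → Near l M H Y → BoundedOffOnes M C →
  (∀ α → classify K α ≡ low → Y α ≡ 0ℤ) →
  Link (l + K) (firstTags p) C G H →
  ∣ + (2 ^ (l + K)) ℤ.* C (ones m) ℤ.- (C (ones m) ℤ.+ Y (firstWord p)) ∣ + (M + M)
    ≤ 2 ^ (l + K) * M + 2 ^ (l + K) * M
entry done l M Y C G H nG nH bC lo link rewrite +-identityʳ l = begin
  ∣ + (2 ^ l) ℤ.* c ℤ.- (c ℤ.+ y) ∣ + (M + M)   ≡⟨ cong (λ i → ∣ i ℤ.- (c ℤ.+ y) ∣ + (M + M)) link ⟩
  ∣ g ℤ.+ h ℤ.- (c ℤ.+ y) ∣ + (M + M)           ≡⟨ cong (λ i → ∣ i ∣ + (M + M)) (split g h c y) ⟩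
  ∣ (g ℤ.- c) ℤ.+ (h ℤ.- y) ∣ + (M + M)         ≤⟨ +-monoˡ-≤ (M + M) (ℤ.∣i+j∣≤∣i∣+∣j∣ (g ℤ.- c) (h ℤ.- y)) ⟩
  ∣ g ℤ.- c ∣ + ∣ h ℤ.- y ∣ + (M + M)           ≡⟨ shuffle ∣ g ℤ.- c ∣ ∣ h ℤ.- y ∣ M ⟩
  (∣ g ℤ.- c ∣ + M) + (∣ h ℤ.- y ∣ + M)         ≤⟨ +-mono-≤ (nG []) (nH []) ⟩
  2 ^ l * M + 2 ^ l * M                         ∎
  where
  open ≤-Reasoning
  c = C []
  g = G []
  h = H []
  y = Y []
  split : ∀ g h c y → g ℤ.+ h ℤ.- (c ℤ.+ y) ≡ (g ℤ.- c) ℤ.+ (h ℤ.- y)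
  split = ℤ-Ring.solve-∀
  shuffle : ∀ a b c → a + b + (c + c) ≡ (a + c) + (b + c)
  shuffle = ℕ-Ring.solve-∀
-- A mirror coordinate: the predecessor has a 1 here and the word itself a 0.
entry (skip p) l M Y C G H nG nH bC lo link =
  entry p l M (half Y false) (half C true) (half G true) (half H false)
    (λ β → nG (true ∷ β)) (λ β → nH (false ∷ β)) (offOnes₁ C bC)
    (λ α eq → lo (false ∷ α) (extend₀-low eq)) link
entry {suc m} (full p) l M Y C G H nG nH bC lo link rewrite +-suc l m =
  entry p (suc l) M (half Y true) (half C true) (halves G) (halves H)
    (near-halves l M G C nG (offOnes₀ C bC))
    (near-halves l M H Y nH λ β →
      ≤-trans (≤-reflexive (cong ∣_∣ (lo (false ∷ β) (extend₀-low (classify-< (n<1+n m) β))))) z≤n)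
    bC₁
    (λ α eq → lo (true ∷ α) (extend₁-low (suc m ≤ᵇ m) eq)) link
  where bC₁ = offOnes₁ C bC

-- As 4M ≤ |c|, the distance of y from (2^L - 1) c is at most half of 2^L |c|. So |y| ≥ (2^(L-1) -
-- 1) |c| ≥ 2^(L-2) |c|. If c = 0, then M = 0 and hence y = 0.
entry-growth : ∀ L M (c y : ℤ) → 4 ≤ L → 4 * M ≤ ∣ c ∣ →
  ∣ + (2 ^ L) ℤ.* c ℤ.- (c ℤ.+ y) ∣ + (M + M) ≤ 2 ^ L * M + 2 ^ L * M →
  2 ^ (L ∸ 2) * ∣ c ∣ ≤ ∣ y ∣ × (∣ c ∣ ≡ 0 → ∣ y ∣ ≡ 0)
entry-growth (suc (suc e)) M c y (s≤s (s≤s 2≤e)) 4M≤ near = lower , vanish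
  where
  open ≤-Reasoning
  P = 2 ^ e
  Q = 2 ^ suc (suc e)
  n = ∣ c ∣
  d = + Q ℤ.* c ℤ.- (c ℤ.+ y)
  Q≡ : Q ≡ 4 * P
  Q≡ = sym (*-assoc 2 2 P)
  regroup : ∀ q c y → q ℤ.* c ≡ (q ℤ.* c ℤ.- (c ℤ.+ y)) ℤ.+ (c ℤ.+ y)
  regroup = ℤ-Ring.solve-∀
  triangle : Q * n ≤ ∣ d ∣ + (n + ∣ y ∣)
  triangle = begin
    Q * n                     ≡⟨ sym (ℤ.abs-* (+ Q) c) ⟩
    ∣ + Q ℤ.* c ∣             ≡⟨ cong ∣_∣ (regroup (+ Q) c y) ⟩
    ∣ d ℤ.+ (c ℤ.+ y) ∣       ≤⟨ ℤ.∣i+j∣≤∣i∣+∣j∣ d (c ℤ.+ y) ⟩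
    ∣ d ∣ + ∣ c ℤ.+ y ∣       ≤⟨ +-monoʳ-≤ ∣ d ∣ (ℤ.∣i+j∣≤∣i∣+∣j∣ c y) ⟩
    ∣ d ∣ + (n + ∣ y ∣)       ∎
  e₁ : ∀ p n → (p * n + n) + (2 * (p * n) + p * n) ≡ 4 * p * n + n
  e₁ = ℕ-Ring.solve-∀
  e₂ : ∀ p k → 4 * p * k + 4 * p * k ≡ 2 * (p * (4 * k))
  e₂ = ℕ-Ring.solve-∀
  e₃ : ∀ p n y → 2 * (p * n) + (n + y) + p * n ≡ (y + n) + (2 * (p * n) + p * n)
  e₃ = ℕ-Ring.solve-∀
  -- 4 P n ≤ 2 P n + n + ∣ y ∣ and n ≤ P n.
  lower : P * n ≤ ∣ y ∣
  lower = +-cancelʳ-≤ n _ _ (+-cancelʳ-≤ (2 * (P * n) + P * n) _ _ (begin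
    P * n + n + (2 * (P * n) + P * n)   ≡⟨ e₁ P n ⟩
    4 * P * n + n                       ≡⟨ cong (λ q → q * n + n) (sym Q≡) ⟩
    Q * n + n                           ≤⟨ +-mono-≤ triangle (m≤n*m n P {{m^n≢0 2 e}}) ⟩
    ∣ d ∣ + (n + ∣ y ∣) + P * n         ≤⟨ +-monoˡ-≤ (P * n) (+-monoˡ-≤ (n + ∣ y ∣) d≤) ⟩
    2 * (P * n) + (n + ∣ y ∣) + P * n   ≡⟨ e₃ P n ∣ y ∣ ⟩
    ∣ y ∣ + n + (2 * (P * n) + P * n)   ∎))
    where
    d≤ : ∣ d ∣ ≤ 2 * (P * n)
    d≤ = begin
      ∣ d ∣                     ≤⟨ m≤m+n ∣ d ∣ (M + M) ⟩
      ∣ d ∣ + (M + M)           ≤⟨ near ⟩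
      Q * M + Q * M             ≡⟨ cong (λ q → q * M + q * M) Q≡ ⟩
      4 * P * M + 4 * P * M     ≡⟨ e₂ P M ⟩
      2 * (P * (4 * M))         ≤⟨ *-monoʳ-≤ 2 (*-monoʳ-≤ P 4M≤) ⟩
      2 * (P * n)               ∎
  vanish : n ≡ 0 → ∣ y ∣ ≡ 0
  vanish n≡0 = n≤0⇒n≡0 (begin
    ∣ y ∣                                 ≡⟨ cong ∣_∣ (solve-y (+ Q) c y) ⟩
    ∣ (+ Q ℤ.* c ℤ.- c) ℤ.- d ∣           ≡⟨ cong (λ i → ∣ (+ Q ℤ.* i ℤ.- i) ℤ.- d ∣) (ℤ.∣i∣≡0⇒i≡0 n≡0) ⟩
    ∣ (+ Q ℤ.* 0ℤ ℤ.- 0ℤ) ℤ.- d ∣         ≡⟨ cong (λ i → ∣ i ∣) (kill (+ Q) d) ⟩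
    ∣ ℤ.- d ∣                             ≡⟨ ℤ.∣-i∣≡∣i∣ d ⟩
    ∣ d ∣                                 ≤⟨ m≤m+n ∣ d ∣ (M + M) ⟩
    ∣ d ∣ + (M + M)                       ≤⟨ near ⟩
    Q * M + Q * M                         ≡⟨ cong (λ k → Q * k + Q * k) M≡0 ⟩
    Q * 0 + Q * 0                         ≡⟨ cong₂ _+_ (*-zeroʳ Q) (*-zeroʳ Q) ⟩
    0                                     ∎)
    where
    M≡0 : M ≡ 0
    M≡0 = n≤0⇒n≡0 (≤-trans (m≤n*m M 4) (≤-trans 4M≤ (≤-reflexive n≡0)))
    solve-y : ∀ q c y → y ≡ (q ℤ.* c ℤ.- c) ℤ.- (q ℤ.* c ℤ.- (c ℤ.+ y))
    solve-y = ℤ-Ring.solve-∀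
    kill : ∀ q d → (q ℤ.* 0ℤ ℤ.- 0ℤ) ℤ.- d ≡ ℤ.- d
    kill = ℤ-Ring.solve-∀

-- Growth along the chain

-- The move from 0 1...1 to the next word, of weight w = `j + pred K + 1`, gains a factor 2^(w - 3).
-- The exponents come from the words starting with 0, from this move, and from the words starting
-- with 1. In `full` no word starting with 0 is heavy enough.
growth : ∀ {m K} → Fits m K → ℕ → ℕ
growth {m} done j = 0
growth {suc m} {K} (skip p) j = growth p j + ((j + pred K ∸ 2) + growth (fits-pred p) (suc j))
growth (full p) j = growth p (suc j)

-- `bound` dominates every word but the last, and `gap` is the ratio 4 that the next move needs.
-- `vanishes` handles a zero start, about which `large` says nothing.
record Grown {m} (M : ℕ) (Y : Word m → ℤ) (start e : ℕ) : Set where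
  field
    bound    : ℕ
    above    : M ≤ bound
    gap      : 4 * bound ≤ ∣ Y (ones m) ∣
    offOnes  : BoundedOffOnes bound Y
    large    : 2 ^ e * start ≤ ∣ Y (ones m) ∣
    vanishes : start ≡ 0 → ∣ Y (ones m) ∣ ≡ 0

  offOnes≤ : ∀ β → ∣ Y β ∣ ≤ ∣ Y (ones m) ∣
  offOnes≤ β with offOnes β
  ... | inj₁ refl = ≤-refl
  ... | inj₂ le   = ≤-trans le (≤-trans (m≤n*m bound 4) gap)

sat₀ : ∀ {m} j (Y Z : Word (suc m) → ℤ) α c →
  Sat j Y Z (false ∷ α) (extend₀ c) → Sat j (half Y false) (half Z false) α c
sat₀ j Y Z α low        s = s
sat₀ j Y Z α (first ts) s = tt
sat₀ j Y Z α (later ts) s = s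

-- A shared 1 restricts `Y` to one half, sums the halves of `Z`, and moves one unit of the exponent
-- from the free tags to `j`. When a first word becomes later, its pivot is here, and `grow` uses
-- that relation directly.
sat₁ : ∀ {m} j b (Y Z : Word (suc m) → ℤ) α c →
  Sat j Y Z (true ∷ α) (extend₁ b c) → Sat (suc j) (half Y true) (halves Z) α c
sat₁ j b     Y Z α low        s = s
sat₁ j b     Y Z α (first ts) s = tt
sat₁ j true  Y Z α (later ts) s rewrite +-suc j (frees ts) = s
sat₁ j false Y Z α (later ts) s rewrite +-suc j (frees ts) = s

level-pred : ∀ {j} K → 5 ≤ j + K → 4 ≤ j + pred K
level-pred {j} zero    le = ≤-trans (n≤1+n 4) le
level-pred {j} (suc K) le = ≤-pred (≤-trans le (≤-reflexive (+-suc j K)))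

level-suc : ∀ {j} K → 5 ≤ j + K → 5 ≤ suc j + pred K
level-suc K le = s≤s (level-pred K le)

-- Here Y is the transform restricted to the words with a given prefix, of weight j, and Z sums these
-- restrictions over all prefixes contained in that one, itself included.
-- Weight 5 gives the factor 2 ^ (5 - 3), which keeps the ratio 4 between y_p and the earlier words.
grow : ∀ {m K} (p : Fits m K) j M (Y Z : Word m → ℤ) → 5 ≤ j + K → Near j M Z Y →
  (∀ α → Sat j Y Z α (classify K α)) → 4 * M ≤ ∣ Y (firstWord p) ∣ →
  Grown M Y ∣ Y (firstWord p) ∣ (growth p j)
grow done j M Y Z 5≤ near sat 4M≤ = record
  { bound    = M
  ; above    = ≤-refl
  ; gap      = 4M≤
  ; offOnes  = λ { [] → inj₁ refl }
  ; large    = ≤-reflexive (*-identityˡ _)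
  ; vanishes = λ eq → eq
  }
grow {suc m} {K} (skip p) j M Y Z 5≤ near sat 4M≤ = record
  { bound    = G₁.bound
  ; above    = ≤-trans M≤V G₁.above
  ; gap      = G₁.gap
  ; offOnes  = λ { (false ∷ β) → inj₂ (≤-trans (G₀.offOnes≤ β) G₁.above) ; (true ∷ β) → off₁ β }
  ; large    = large
  ; vanishes = λ eq → G₁.vanishes (proj₂ step (G₀.vanishes eq))
  }
  where
  q = fits-pred p
  L = j + pred K
  y₁ = ∣ Y (firstWord (skip p)) ∣
  module G₀ = Grown (grow p j M (half Y false) (half Z false) 5≤ (λ β → near (false ∷ β))
    (λ α → sat₀ j Y Z α (classify K α) (sat (false ∷ α))) 4M≤)
  V = ∣ Y (false ∷ ones m) ∣
  M≤V : M ≤ V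
  M≤V = ≤-trans G₀.above (≤-trans (m≤n*m G₀.bound 4) G₀.gap)
  classify-true : ∀ α → classify K (true ∷ α) ≡ extend₁ true (classify (pred K) α)
  classify-true α = cong (λ b → extend₁ b (classify (pred K) α)) (≤ᵇ-true p)
  sat-true : ∀ α → Sat j Y Z (true ∷ α) (extend₁ true (classify (pred K) α))
  sat-true α = subst (Sat j Y Z (true ∷ α)) (classify-true α) (sat (true ∷ α))
  near₀ : Near j G₀.bound Z Y
  near₀ = near-mono j {Z = Z} {Y = Y} G₀.above near
  low-zero : ∀ α → classify (pred K) α ≡ low → Y (true ∷ α) ≡ 0ℤ
  low-zero α eq = subst (Sat j Y Z (true ∷ α)) (extend₁-low true eq) (sat-true α)
  -- The first word starting with 1 has its pivot here, so C and G take the half starting with 0,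
  -- and H the other.
  link : Link (j + pred K) (firstTags q) (half Y false) (half Z false) (half Z true)
  link = subst (λ k → Link (j + k) (firstTags q) (half Y false) (half Z false) (half Z true)) (frees-firstTags q)
    (subst (λ c → Sat j Y Z (true ∷ firstWord q) (extend₁ true c)) (classify-firstWord q) (sat-true (firstWord q)))
  step : 2 ^ (L ∸ 2) * V ≤ ∣ Y (true ∷ firstWord q) ∣ × (V ≡ 0 → ∣ Y (true ∷ firstWord q) ∣ ≡ 0)
  step = entry-growth L G₀.bound (Y (false ∷ ones m)) (Y (true ∷ firstWord q)) (level-pred K 5≤) G₀.gap
    (entry q j G₀.bound (half Y true) (half Y false) (half Z false) (half Z true)
      (λ β → near₀ (false ∷ β)) (λ β → near₀ (true ∷ β)) G₀.offOnes low-zero link)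
  4V≤ : 4 * V ≤ ∣ Y (true ∷ firstWord q) ∣
  4V≤ = ≤-trans (*-monoˡ-≤ V (^-monoʳ-≤ 2 (∸-monoˡ-≤ 2 (level-pred K 5≤)))) (proj₁ step)
  -- The second half starts from the bound `V`, the last and largest entry of the first half.
  module G₁ = Grown (grow q (suc j) V (half Y true) (halves Z) (level-suc K 5≤)
    (near-halves j V Z Y (near-mono j {Z = Z} {Y = Y} M≤V near) G₀.offOnes≤)
    (λ α → sat₁ j true Y Z α (classify (pred K) α) (sat-true α)) 4V≤)
  off₁ : ∀ β → true ∷ β ≡ ones (suc m) ⊎ ∣ Y (true ∷ β) ∣ ≤ G₁.bound
  off₁ β with G₁.offOnes β
  ... | inj₁ eq = inj₁ (cong (true ∷_) eq)
  ... | inj₂ le = inj₂ le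
  large : 2 ^ growth (skip p) j * y₁ ≤ ∣ Y (ones (suc m)) ∣
  large = begin
    2 ^ (e₀ + ((L ∸ 2) + e₁)) * y₁               ≡⟨ cong (_* y₁) (^-distribˡ-+-* 2 e₀ ((L ∸ 2) + e₁)) ⟩
    2 ^ e₀ * 2 ^ ((L ∸ 2) + e₁) * y₁             ≡⟨ cong (λ k → 2 ^ e₀ * k * y₁) (^-distribˡ-+-* 2 (L ∸ 2) e₁) ⟩
    2 ^ e₀ * (2 ^ (L ∸ 2) * 2 ^ e₁) * y₁         ≡⟨ regroup (2 ^ e₀) (2 ^ (L ∸ 2)) (2 ^ e₁) y₁ ⟩
    2 ^ e₁ * (2 ^ (L ∸ 2) * (2 ^ e₀ * y₁))       ≤⟨ *-monoʳ-≤ (2 ^ e₁) (*-monoʳ-≤ (2 ^ (L ∸ 2)) G₀.large) ⟩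
    2 ^ e₁ * (2 ^ (L ∸ 2) * V)                      ≤⟨ *-monoʳ-≤ (2 ^ e₁) (proj₁ step) ⟩
    2 ^ e₁ * ∣ Y (true ∷ firstWord q) ∣             ≤⟨ G₁.large ⟩
    ∣ Y (ones (suc m)) ∣                            ∎
    where
    open ≤-Reasoning
    e₀ = growth p j
    e₁ = growth q (suc j)
    regroup : ∀ a b c s → a * (b * c) * s ≡ c * (b * (a * s))
    regroup = ℕ-Ring.solve-∀
grow {suc m} (full p) j M Y Z 5≤ near sat 4M≤ = record
  { bound    = G.bound
  ; above    = G.above
  ; gap      = G.gap
  ; offOnes  = λ { (false ∷ β) → inj₂ (≤-trans (half≤ β) z≤n) ; (true ∷ β) → off₁ β }
  ; large    = G.large
  ; vanishes = G.vanishes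
  }
  where
  -- A word starting with 0 has weight at most `m` after it, below the required `suc m`, so its
  -- entry is 0.
  half≤ : ∀ β → ∣ Y (false ∷ β) ∣ ≤ 0
  half≤ β = ≤-reflexive (cong ∣_∣ (subst (Sat j Y Z (false ∷ β))
    (extend₀-low (classify-< (n<1+n m) β)) (sat (false ∷ β))))
  module G = Grown (grow p (suc j) M (half Y true) (halves Z) (level-suc (suc m) 5≤)
    (near-halves j M Z Y near (λ β → ≤-trans (half≤ β) z≤n))
    (λ α → sat₁ j (suc m ≤ᵇ m) Y Z α (classify m α) (sat (true ∷ α))) 4M≤)
  off₁ : ∀ β → true ∷ β ≡ ones (suc m) ⊎ ∣ Y (true ∷ β) ∣ ≤ G.bound
  off₁ β with G.offOnes β
  ... | inj₁ eq = inj₁ (cong (true ∷_) eq)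
  ... | inj₂ le = inj₂ le

-- Over all words, twice the weight, the `j` ones of the prefix included, adds up to (2j + m) 2^m. A
-- word reached by a move adds 2 (w - 3) on the right, and a low word, of weight below 5, adds
-- nothing: 10 per word makes up for both. The first word counts its full weight `j + K`, so its 10
-- is not spent.
growth-bound : ∀ {m K} (p : Fits m K) j → 5 ≤ j + K → K ≡ 0 ⊎ j + K ≤ 5 →
  (2 * j + m) * 2 ^ m + 10 ≤ 2 * growth p j + 2 * (j + K) + 10 * 2 ^ m
growth-bound done j 5≤ inv = ≤-reflexive (base j)
  where
  base : ∀ j → (2 * j + 0) * 1 + 10 ≡ 0 + 2 * (j + 0) + 10 * 1
  base = ℕ-Ring.solve-∀
growth-bound {suc m} {K} (skip p) j 5≤ inv = +-cancelʳ-≤ 6 _ _ (begin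
  -- The first word starting with 1 counts 2w in its own half but 2 (w - 3) as the target of a move:
  -- the difference 6 comes out of its 10, and 4 remain.
  (2 * j + suc m) * (2 * N) + 10 + 6                       ≤⟨ m≤m+n _ 4 ⟩
  (2 * j + suc m) * (2 * N) + 10 + 6 + 4                   ≡⟨ lhs j m N ⟩
  ((2 * j + m) * N + 10) + ((2 * suc j + m) * N + 10)      ≤⟨ +-mono-≤ (growth-bound p j 5≤ inv) (growth-bound q (suc j) (level-suc K 5≤) (inv-pred K inv)) ⟩
  (2 * e₀ + 2 * (j + K) + 10 * N) + (2 * e₁ + 2 * (suc (j + pred K)) + 10 * N)
                                                           ≡⟨ cong (λ l → (2 * e₀ + 2 * (j + K) + 10 * N) + (2 * e₁ + 2 * suc l + 10 * N)) (sym (m+[n∸m]≡n 2≤)) ⟩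
  (2 * e₀ + 2 * (j + K) + 10 * N) + (2 * e₁ + 2 * suc (2 + d) + 10 * N)
                                                           ≡⟨ rhs e₀ e₁ (j + K) d N ⟩
  2 * (e₀ + (d + e₁)) + 2 * (j + K) + 10 * (2 * N) + 6     ∎)
  where
  open ≤-Reasoning
  q = fits-pred p
  N = 2 ^ m
  e₀ = growth p j
  e₁ = growth q (suc j)
  d = j + pred K ∸ 2
  2≤ : 2 ≤ j + pred K
  2≤ = ≤-trans (s≤s (s≤s z≤n)) (level-pred {j} K 5≤)
  inv-pred : ∀ K → K ≡ 0 ⊎ j + K ≤ 5 → pred K ≡ 0 ⊎ suc j + pred K ≤ 5
  inv-pred zero    _         = inj₁ refl
  inv-pred (suc K) (inj₂ le) = inj₂ (≤-trans (≤-reflexive (sym (+-suc j K))) le)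
  lhs : ∀ j m N → (2 * j + (1 + m)) * (2 * N) + 10 + 6 + 4 ≡ ((2 * j + m) * N + 10) + ((2 * (1 + j) + m) * N + 10)
  lhs = ℕ-Ring.solve-∀
  rhs : ∀ a b l d N → (2 * a + 2 * l + 10 * N) + (2 * b + 2 * (1 + (2 + d)) + 10 * N)
    ≡ 2 * (a + (d + b)) + 2 * l + 10 * (2 * N) + 6
  rhs = ℕ-Ring.solve-∀
growth-bound {suc m} (full p) j 5≤ (inj₂ ≤5) = begin
  (2 * j + suc m) * (2 * N) + 10                        ≡⟨ lhs j m N ⟩
  ((2 * suc j + m) * N + 10) + (2 * j + m) * N          ≤⟨ +-mono-≤ (growth-bound p (suc j) (level-suc {j} (suc m) 5≤) (inj₂ (≤-trans (≤-reflexive (sym (+-suc j m))) ≤5))) (*-monoˡ-≤ N few) ⟩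
  (2 * e + 2 * (suc j + m) + 10 * N) + 10 * N           ≡⟨ rhs e j m N ⟩
  2 * e + 2 * (j + suc m) + 10 * (2 * N)                ∎
  where
  open ≤-Reasoning
  N = 2 ^ m
  e = growth p (suc j)
  -- This is the average doubled weight of the words starting with 0, all of them low.
  few : 2 * j + m ≤ 10
  few = begin
    2 * j + m             ≤⟨ m≤m+n _ (m + 2) ⟩
    2 * j + m + (m + 2)   ≡⟨ fold j m ⟩
    2 * (j + suc m)       ≤⟨ *-monoʳ-≤ 2 ≤5 ⟩
    10                    ∎
    where
    fold : ∀ j m → 2 * j + m + (m + 2) ≡ 2 * (j + (1 + m))
    fold = ℕ-Ring.solve-∀
  lhs : ∀ j m N → (2 * j + (1 + m)) * (2 * N) + 10 ≡ ((2 * (1 + j) + m) * N + 10) + (2 * j + m) * N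
  lhs = ℕ-Ring.solve-∀
  rhs : ∀ e j m N → (2 * e + 2 * (1 + j + m) + 10 * N) + 10 * N ≡ 2 * e + 2 * (j + (1 + m)) + 10 * (2 * N)
  rhs = ℕ-Ring.solve-∀

-- Zero-sum families of signed columns

∑ : ∀ {A : Set} → List A → (A → ℤ) → ℤ
∑ []       F = 0ℤ
∑ (a ∷ xs) F = F a ℤ.+ ∑ xs F

module _ {A : Set} where
  ∑-cong : ∀ (xs : List A) {F G : A → ℤ} → (∀ a → F a ≡ G a) → ∑ xs F ≡ ∑ xs G
  ∑-cong []       eq = refl
  ∑-cong (a ∷ xs) eq = cong₂ ℤ._+_ (eq a) (∑-cong xs eq)

  ∑-+ : ∀ (xs : List A) (F G : A → ℤ) → ∑ xs (λ a → F a ℤ.+ G a) ≡ ∑ xs F ℤ.+ ∑ xs G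
  ∑-+ []       F G = refl
  ∑-+ (a ∷ xs) F G = trans (cong (ℤ._+_ (F a ℤ.+ G a)) (∑-+ xs F G)) (swap (F a) (G a) (∑ xs F) (∑ xs G))
    where
    swap : ∀ a b c d → a ℤ.+ b ℤ.+ (c ℤ.+ d) ≡ (a ℤ.+ c) ℤ.+ (b ℤ.+ d)
    swap = ℤ-Ring.solve-∀

  ∑-* : ∀ (xs : List A) k (F : A → ℤ) → ∑ xs (λ a → k ℤ.* F a) ≡ k ℤ.* ∑ xs F
  ∑-* []       k F = sym (ℤ.*-zeroʳ k)
  ∑-* (a ∷ xs) k F = trans (cong (ℤ._+_ (k ℤ.* F a)) (∑-* xs k F)) (sym (ℤ.*-distribˡ-+ k (F a) (∑ xs F)))

  ∑-1 : ∀ (xs : List A) → ∑ xs (λ _ → 1ℤ) ≡ + length xs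
  ∑-1 []       = refl
  ∑-1 (a ∷ xs) = cong (ℤ._+_ 1ℤ) (∑-1 xs)

  ∣∑∣≤length : ∀ (xs : List A) (F : A → ℤ) → (∀ a → ∣ F a ∣ ≤ 1) → ∣ ∑ xs F ∣ ≤ length xs
  ∣∑∣≤length []       F le = z≤n
  ∣∑∣≤length (a ∷ xs) F le = ≤-trans (ℤ.∣i+j∣≤∣i∣+∣j∣ (F a) (∑ xs F)) (+-mono-≤ (le a) (∣∑∣≤length xs F le))

-- Signs and the rows as sign vectors

IsSign : ℤ → Set
IsSign i = i ≡ 1ℤ ⊎ i ≡ -1ℤ

sign-neg : ∀ {i} → IsSign i → IsSign (ℤ.- i)
sign-neg (inj₁ refl) = inj₂ refl
sign-neg (inj₂ refl) = inj₁ refl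

sign-* : ∀ {i j} → IsSign i → IsSign j → IsSign (i ℤ.* j)
sign-* (inj₁ refl) (inj₁ refl) = inj₁ refl
sign-* (inj₁ refl) (inj₂ refl) = inj₂ refl
sign-* (inj₂ refl) (inj₁ refl) = inj₂ refl
sign-* (inj₂ refl) (inj₂ refl) = inj₁ refl

sign-abs : ∀ {i} → IsSign i → ∣ i ∣ ≤ 1
sign-abs (inj₁ refl) = ≤-refl
sign-abs (inj₂ refl) = ≤-refl

sign-square : ∀ {i} → IsSign i → i ℤ.* i ≡ 1ℤ
sign-square (inj₁ refl) = refl
sign-square (inj₂ refl) = refl

factor-sign : ∀ b → IsSign (factor sign b)
factor-sign false = inj₁ refl
factor-sign true  = inj₂ refl

χ-sign : ∀ {m} (β x : Word m) → IsSign (χ β x)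
χ-sign []          []      = inj₁ refl
χ-sign (false ∷ β) (b ∷ x) = χ-sign β x
χ-sign (true ∷ β)  (b ∷ x) = sign-* (factor-sign b) (χ-sign β x)

-- The first word has no predecessor, so its row is free to be the second copy of the constant row;
-- the first copy is the character of the zero word.
row : ∀ {m} → Class m → Word m → Word m → ℤ
row low        α x = χ α x
row (first ts) α x = 1ℤ
row (later ts) α x = eval (map tagC ts) x ℤ.- eval (map tagG ts) x ℤ.- eval (map tagH ts) x

-- C - G - H is C where G vanishes and - H elsewhere.
module _ {m} (ts : Vec Tag m) (x : Word m) where
  private
    c = eval (map tagC ts) x
    g = eval (map tagG ts) x
    h = eval (map tagH ts) x
  Split : Set
  Split = IsSign c × (g ≡ 0ℤ × h ≡ 0ℤ ⊎ g ≡ c × IsSign h)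

tag-split : ∀ {m} (ts : Vec Tag m) x → Split ts x
tag-split []           []      = inj₁ refl , inj₂ (refl , inj₁ refl)
tag-split (t ∷ ts) (b ∷ x) with tag-split ts x
tag-split (both0 ∷ ts) (b ∷ x) | s , inj₁ (g0 , h0) =
  sign-* (inj₁ refl) s , inj₁ (cong (1ℤ ℤ.*_) g0 , cong (1ℤ ℤ.*_) h0)
tag-split (both0 ∷ ts) (b ∷ x) | s , inj₂ (g≡ , sh) =
  sign-* (inj₁ refl) s , inj₂ (cong (1ℤ ℤ.*_) g≡ , sign-* (inj₁ refl) sh)
tag-split (both1 ∷ ts) (false ∷ x) | s , inj₁ (g0 , h0) =
  sign-* (inj₁ refl) s , inj₁ (cong (1ℤ ℤ.*_) g0 , cong (1ℤ ℤ.*_) h0)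
tag-split (both1 ∷ ts) (false ∷ x) | s , inj₂ (g≡ , sh) =
  sign-* (inj₁ refl) s , inj₂ (cong (1ℤ ℤ.*_) g≡ , sign-* (inj₁ refl) sh)
tag-split (both1 ∷ ts) (true ∷ x) | s , _ = sign-* (inj₂ refl) s , inj₁ (refl , refl)
tag-split (pivot ∷ ts) (b ∷ x) | s , inj₁ (g0 , h0) =
  sign-* (inj₁ refl) s , inj₁ (cong (1ℤ ℤ.*_) g0 , trans (cong (factor sign b ℤ.*_) h0) (ℤ.*-zeroʳ (factor sign b)))
tag-split (pivot ∷ ts) (b ∷ x) | s , inj₂ (g≡ , sh) =
  sign-* (inj₁ refl) s , inj₂ (cong (1ℤ ℤ.*_) g≡ , sign-* (factor-sign b) sh)
tag-split (mirror ∷ ts) (b ∷ x) | s , inj₁ (g0 , h0) =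
  sign-* (factor-sign b) s , inj₁ (trans (cong (factor sign b ℤ.*_) g0) (ℤ.*-zeroʳ (factor sign b)) , cong (1ℤ ℤ.*_) h0)
tag-split (mirror ∷ ts) (b ∷ x) | s , inj₂ (g≡ , sh) =
  sign-* (factor-sign b) s , inj₂ (cong (factor sign b ℤ.*_) g≡ , sign-* (inj₁ refl) sh)

row-sign : ∀ {m} (c : Class m) α x → IsSign (row c α x)
row-sign low        α x = χ-sign α x
row-sign (first ts) α x = inj₁ refl
row-sign (later ts) α x with tag-split ts x
... | s , inj₁ (g0 , h0) = subst IsSign (sym eq) s
  where
  eq : row (later ts) α x ≡ eval (map tagC ts) x
  eq = trans (cong₂ (λ g h → eval (map tagC ts) x ℤ.- g ℤ.- h) g0 h0)
         (trans (ℤ.+-identityʳ _) (ℤ.+-identityʳ _))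
... | s , inj₂ (g≡ , sh) = subst IsSign (sym eq) (sign-neg sh)
  where
  eq : row (later ts) α x ≡ ℤ.- eval (map tagH ts) x
  eq = trans (cong (λ g → eval (map tagC ts) x ℤ.- g ℤ.- eval (map tagH ts) x) g≡)
         (cancel (eval (map tagC ts) x) (eval (map tagH ts) x))
    where
    cancel : ∀ c h → c ℤ.- c ℤ.- h ≡ ℤ.- h
    cancel = ℤ-Ring.solve-∀

-- Pairings read off the transform

dual-cong : ∀ {m} (φ : Vec Factor m) {U V : Word m → ℤ} → (∀ β → U β ≡ V β) → dual φ U ≡ dual φ V
dual-cong []         eq = eq []
dual-cong (one  ∷ φ) eq = dual-cong φ (λ β → eq (false ∷ β))
dual-cong (sign ∷ φ) eq = dual-cong φ (λ β → eq (true ∷ β))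
dual-cong (ind  ∷ φ) eq = dual-cong φ (λ β → cong₂ ℤ._+_ (eq (false ∷ β)) (eq (true ∷ β)))

dual-+ : ∀ {m} (φ : Vec Factor m) (U V : Word m → ℤ) → dual φ (λ β → U β ℤ.+ V β) ≡ dual φ U ℤ.+ dual φ V
dual-+ []         U V = refl
dual-+ (one  ∷ φ) U V = dual-+ φ (half U false) (half V false)
dual-+ (sign ∷ φ) U V = dual-+ φ (half U true) (half V true)
dual-+ (ind  ∷ φ) U V = trans
  (dual-cong φ (λ β → swap (U (false ∷ β)) (V (false ∷ β)) (U (true ∷ β)) (V (true ∷ β))))
  (dual-+ φ (halves U) (halves V))
  where
  swap : ∀ a b c d → a ℤ.+ b ℤ.+ (c ℤ.+ d) ≡ (a ℤ.+ c) ℤ.+ (b ℤ.+ d)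
  swap = ℤ-Ring.solve-∀

dual-* : ∀ {m} (φ : Vec Factor m) k (U : Word m → ℤ) → dual φ (λ β → k ℤ.* U β) ≡ k ℤ.* dual φ U
dual-* []         k U = refl
dual-* (one  ∷ φ) k U = dual-* φ k (half U false)
dual-* (sign ∷ φ) k U = dual-* φ k (half U true)
dual-* (ind  ∷ φ) k U = trans
  (dual-cong φ (λ β → sym (ℤ.*-distribˡ-+ k (U (false ∷ β)) (U (true ∷ β)))))
  (dual-* φ k (halves U))

dual-∑ : ∀ {m} (φ : Vec Factor m) {A : Set} (xs : List A) (F : A → Word m → ℤ) →
  dual φ (λ β → ∑ xs (λ a → F a β)) ≡ ∑ xs (λ a → dual φ (F a))
dual-∑ φ []       F = dual-* φ 0ℤ (λ _ → 0ℤ)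
dual-∑ φ (a ∷ xs) F = trans (dual-+ φ (F a) (λ β → ∑ xs (λ a → F a β))) (cong (ℤ._+_ (dual φ (F a))) (dual-∑ φ xs F))

inds : ∀ {m} → Vec Factor m → ℕ
inds []         = 0
inds (one  ∷ φ) = inds φ
inds (sign ∷ φ) = inds φ
inds (ind  ∷ φ) = suc (inds φ)

inds-C : ∀ {m} (ts : Vec Tag m) → inds (map tagC ts) ≡ 0
inds-C []            = refl
inds-C (both0 ∷ ts)  = inds-C ts
inds-C (both1 ∷ ts)  = inds-C ts
inds-C (pivot ∷ ts)  = inds-C ts
inds-C (mirror ∷ ts) = inds-C ts

inds-G : ∀ {m} (ts : Vec Tag m) → inds (map tagG ts) ≡ frees ts
inds-G []            = refl
inds-G (both0 ∷ ts)  = inds-G ts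
inds-G (both1 ∷ ts)  = cong suc (inds-G ts)
inds-G (pivot ∷ ts)  = inds-G ts
inds-G (mirror ∷ ts) = inds-G ts

inds-H : ∀ {m} (ts : Vec Tag m) → inds (map tagH ts) ≡ frees ts
inds-H []            = refl
inds-H (both0 ∷ ts)  = inds-H ts
inds-H (both1 ∷ ts)  = cong suc (inds-H ts)
inds-H (pivot ∷ ts)  = inds-H ts
inds-H (mirror ∷ ts) = inds-H ts

dual-χ : ∀ {m} (φ : Vec Factor m) (x : Word m) → dual φ (λ β → χ β x) ≡ + (2 ^ inds φ) ℤ.* eval φ x
dual-χ []         []      = refl
dual-χ (one  ∷ φ) (b ∷ x) = trans (dual-χ φ x) (cong (+ (2 ^ inds φ) ℤ.*_) (sym (ℤ.*-identityˡ (eval φ x))))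
dual-χ (sign ∷ φ) (b ∷ x) = trans (dual-* φ (factor sign b) (λ β → χ β x))
  (trans (cong (factor sign b ℤ.*_) (dual-χ φ x)) (swap (factor sign b) (+ (2 ^ inds φ)) (eval φ x)))
  where
  swap : ∀ s p e → s ℤ.* (p ℤ.* e) ≡ p ℤ.* (s ℤ.* e)
  swap = ℤ-Ring.solve-∀
dual-χ (ind  ∷ φ) (b ∷ x) = begin
  dual φ (λ β → χ β x ℤ.+ factor sign b ℤ.* χ β x)        ≡⟨ dual-cong φ (λ β → sum-b b (χ β x)) ⟩
  dual φ (λ β → + 2 ℤ.* factor ind b ℤ.* χ β x)           ≡⟨ dual-* φ (+ 2 ℤ.* factor ind b) (λ β → χ β x) ⟩
  + 2 ℤ.* factor ind b ℤ.* dual φ (λ β → χ β x)           ≡⟨ cong (+ 2 ℤ.* factor ind b ℤ.*_) (dual-χ φ x) ⟩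
  + 2 ℤ.* factor ind b ℤ.* (+ (2 ^ inds φ) ℤ.* eval φ x)  ≡⟨ swap (+ 2) (factor ind b) (+ (2 ^ inds φ)) (eval φ x) ⟩
  + 2 ℤ.* + (2 ^ inds φ) ℤ.* (factor ind b ℤ.* eval φ x)  ≡⟨ cong (ℤ._* (factor ind b ℤ.* eval φ x)) (sym (ℤ.pos-* 2 (2 ^ inds φ))) ⟩
  + (2 ^ suc (inds φ)) ℤ.* (factor ind b ℤ.* eval φ x)    ∎
  where
  open ≡-Reasoning
  sum-b : ∀ b i → i ℤ.+ factor sign b ℤ.* i ≡ + 2 ℤ.* factor ind b ℤ.* i
  sum-b false = ℤ-Ring.solve-∀
  sum-b true  = ℤ-Ring.solve-∀
  swap : ∀ t f p e → t ℤ.* f ℤ.* (p ℤ.* e) ≡ t ℤ.* p ℤ.* (f ℤ.* e)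
  swap = ℤ-Ring.solve-∀

module Transform {m : ℕ} (xs : List (Word m)) (σ : Word m → ℤ) where
  Y : Word m → ℤ
  Y β = ∑ xs λ x → σ x ℤ.* χ β x

  dual-Y : ∀ φ → dual φ Y ≡ + (2 ^ inds φ) ℤ.* ∑ xs (λ x → σ x ℤ.* eval φ x)
  dual-Y φ = begin
    dual φ Y                                                 ≡⟨ dual-∑ φ xs (λ x β → σ x ℤ.* χ β x) ⟩
    ∑ xs (λ x → dual φ (λ β → σ x ℤ.* χ β x))                ≡⟨ ∑-cong xs (λ x → trans (dual-* φ (σ x) (λ β → χ β x)) (cong (σ x ℤ.*_) (dual-χ φ x))) ⟩
    ∑ xs (λ x → σ x ℤ.* (P ℤ.* eval φ x))                    ≡⟨ ∑-cong xs (λ x → swap (σ x) P (eval φ x)) ⟩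
    ∑ xs (λ x → P ℤ.* (σ x ℤ.* eval φ x))                    ≡⟨ ∑-* xs P (λ x → σ x ℤ.* eval φ x) ⟩
    P ℤ.* ∑ xs (λ x → σ x ℤ.* eval φ x)                      ∎
    where
    open ≡-Reasoning
    P = + (2 ^ inds φ)
    swap : ∀ s p e → s ℤ.* (p ℤ.* e) ≡ p ℤ.* (s ℤ.* e)
    swap = ℤ-Ring.solve-∀

  -- Orthogonality to C - G - H makes the pairing with C the sum of those with G and H. Each of G
  -- and H has `frees ts` indicator factors and C has none; hence the power of 2.
  sat : ∀ α c → ∑ xs (λ x → σ x ℤ.* row c α x) ≡ 0ℤ → Sat 0 Y Y α c
  sat α low        eq = eq
  sat α (first ts) eq = tt
  sat α (later ts) eq = begin
    P ℤ.* dual φC Y                 ≡⟨ cong (P ℤ.*_) (trans (dual-Y φC) (cong (λ n → + (2 ^ n) ℤ.* s φC) (inds-C ts))) ⟩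
    P ℤ.* (1ℤ ℤ.* s φC)             ≡⟨ cong (λ i → P ℤ.* (1ℤ ℤ.* i)) sC≡ ⟩
    P ℤ.* (1ℤ ℤ.* (s φG ℤ.+ s φH))  ≡⟨ distrib P (s φG) (s φH) ⟩
    P ℤ.* s φG ℤ.+ P ℤ.* s φH       ≡⟨ sym (cong₂ (λ n k → + (2 ^ n) ℤ.* s φG ℤ.+ + (2 ^ k) ℤ.* s φH) (inds-G ts) (inds-H ts)) ⟩
    + (2 ^ inds φG) ℤ.* s φG ℤ.+ + (2 ^ inds φH) ℤ.* s φH
                                    ≡⟨ sym (cong₂ ℤ._+_ (dual-Y φG) (dual-Y φH)) ⟩
    dual φG Y ℤ.+ dual φH Y         ∎
    where
    open ≡-Reasoning
    P = + (2 ^ frees ts)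
    φC = map tagC ts
    φG = map tagG ts
    φH = map tagH ts
    s : Vec Factor m → ℤ
    s φ = ∑ xs λ x → σ x ℤ.* eval φ x
    distrib : ∀ p g h → p ℤ.* (1ℤ ℤ.* (g ℤ.+ h)) ≡ p ℤ.* g ℤ.+ p ℤ.* h
    distrib = ℤ-Ring.solve-∀
    expand : ∀ s c g h → s ℤ.* c ≡ s ℤ.* (c ℤ.- g ℤ.- h) ℤ.+ (s ℤ.* g ℤ.+ s ℤ.* h)
    expand = ℤ-Ring.solve-∀
    sC≡ : s φC ≡ s φG ℤ.+ s φH
    sC≡ = begin
      s φC  ≡⟨ ∑-cong xs (λ x → expand (σ x) (eval φC x) (eval φG x) (eval φH x)) ⟩
      ∑ xs (λ x → σ x ℤ.* row (later ts) α x ℤ.+ (σ x ℤ.* eval φG x ℤ.+ σ x ℤ.* eval φH x))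
            ≡⟨ ∑-+ xs (λ x → σ x ℤ.* row (later ts) α x) (λ x → σ x ℤ.* eval φG x ℤ.+ σ x ℤ.* eval φH x) ⟩
      ∑ xs (λ x → σ x ℤ.* row (later ts) α x) ℤ.+ ∑ xs (λ x → σ x ℤ.* eval φG x ℤ.+ σ x ℤ.* eval φH x)
            ≡⟨ cong₂ ℤ._+_ eq (∑-+ xs (λ x → σ x ℤ.* eval φG x) (λ x → σ x ℤ.* eval φH x)) ⟩
      0ℤ ℤ.+ (s φG ℤ.+ s φH) ≡⟨ ℤ.+-identityˡ _ ⟩
      s φG ℤ.+ s φH ∎

-- The characters span: expand g in its first coordinate and recurse with the weights w and w · (-1)^b.
χ-spanning : ∀ {m} {A : Set} (xs : List A) (w : A → ℤ) (x : A → Word m) →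
  (∀ β → ∑ xs (λ a → w a ℤ.* χ β (x a)) ≡ 0ℤ) → ∀ (g : Word m → ℤ) → ∑ xs (λ a → w a ℤ.* g (x a)) ≡ 0ℤ
χ-spanning {zero} xs w x zero-χ g = begin
  ∑ xs (λ a → w a ℤ.* g (x a))            ≡⟨ ∑-cong xs (λ a → to-χ a) ⟩
  ∑ xs (λ a → g [] ℤ.* (w a ℤ.* χ [] (x a)))  ≡⟨ ∑-* xs (g []) (λ a → w a ℤ.* χ [] (x a)) ⟩
  g [] ℤ.* ∑ xs (λ a → w a ℤ.* χ [] (x a))  ≡⟨ cong (g [] ℤ.*_) (zero-χ []) ⟩
  g [] ℤ.* 0ℤ                             ≡⟨ ℤ.*-zeroʳ (g []) ⟩
  0ℤ                                      ∎
  where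
  open ≡-Reasoning
  swap : ∀ w g → w ℤ.* g ≡ g ℤ.* (w ℤ.* 1ℤ)
  swap = ℤ-Ring.solve-∀
  to-χ : ∀ a → w a ℤ.* g (x a) ≡ g [] ℤ.* (w a ℤ.* χ [] (x a))
  to-χ a with x a
  ... | [] = swap (w a) (g [])
χ-spanning {suc m} {A} xs w x zero-χ g = ℤ.*-cancelˡ-≡ (+ 2) _ _ (begin
  + 2 ℤ.* ∑ xs (λ a → w a ℤ.* g (x a))       ≡⟨ sym (∑-* xs (+ 2) (λ a → w a ℤ.* g (x a))) ⟩
  ∑ xs (λ a → + 2 ℤ.* (w a ℤ.* g (x a)))     ≡⟨ ∑-cong xs expand ⟩
  ∑ xs (λ a → w a ℤ.* g₊ (t a) ℤ.+ w₁ a ℤ.* g₋ (t a))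
                                             ≡⟨ ∑-+ xs (λ a → w a ℤ.* g₊ (t a)) (λ a → w₁ a ℤ.* g₋ (t a)) ⟩
  ∑ xs (λ a → w a ℤ.* g₊ (t a)) ℤ.+ ∑ xs (λ a → w₁ a ℤ.* g₋ (t a))
                                             ≡⟨ cong₂ ℤ._+_ (χ-spanning xs w t zero₀ g₊) (χ-spanning xs w₁ t zero₁ g₋) ⟩
  0ℤ                                         ∎)
  where
  open ≡-Reasoning
  t : A → Word m
  t = Vec.tail ∘ x
  w₁ : A → ℤ
  w₁ a = w a ℤ.* factor sign (Vec.head (x a))
  g₊ g₋ : Word m → ℤ
  g₊ y = g (false ∷ y) ℤ.+ g (true ∷ y)
  g₋ y = g (false ∷ y) ℤ.- g (true ∷ y)
  e₀ : ∀ w p q → + 2 ℤ.* (w ℤ.* p) ≡ w ℤ.* (p ℤ.+ q) ℤ.+ w ℤ.* 1ℤ ℤ.* (p ℤ.- q)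
  e₀ = ℤ-Ring.solve-∀
  e₁ : ∀ w p q → + 2 ℤ.* (w ℤ.* q) ≡ w ℤ.* (p ℤ.+ q) ℤ.+ w ℤ.* -1ℤ ℤ.* (p ℤ.- q)
  e₁ = ℤ-Ring.solve-∀
  expand : ∀ a → + 2 ℤ.* (w a ℤ.* g (x a)) ≡ w a ℤ.* g₊ (t a) ℤ.+ w₁ a ℤ.* g₋ (t a)
  expand a with x a
  ... | false ∷ y = e₀ (w a) (g (false ∷ y)) (g (true ∷ y))
  ... | true  ∷ y = e₁ (w a) (g (false ∷ y)) (g (true ∷ y))
  χ-false : ∀ a β → χ (false ∷ β) (x a) ≡ χ β (t a)
  χ-false a β with x a
  ... | b ∷ y = refl
  χ-true : ∀ a β → χ (true ∷ β) (x a) ≡ factor sign (Vec.head (x a)) ℤ.* χ β (t a)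
  χ-true a β with x a
  ... | b ∷ y = refl
  zero₀ : ∀ β → ∑ xs (λ a → w a ℤ.* χ β (t a)) ≡ 0ℤ
  zero₀ β = trans (∑-cong xs (λ a → cong (w a ℤ.*_) (sym (χ-false a β)))) (zero-χ (false ∷ β))
  zero₁ : ∀ β → ∑ xs (λ a → w₁ a ℤ.* χ β (t a)) ≡ 0ℤ
  zero₁ β = trans (∑-cong xs (λ a → trans (ℤ.*-assoc (w a) _ _) (cong (w a ℤ.*_) (sym (χ-true a β))))) (zero-χ (true ∷ β))

-- `grow` is applied with the empty prefix, where `Z` is `Y`, and with M = 0. The last entry of the
-- transform is a sum of `length xs` signs, so its size bounds the length from below.
zero-sum-long : ∀ {m} (p : Fits m 5) (σ : Word m → ℤ) → (∀ x → IsSign (σ x)) → ∀ xs → 1 ≤ length xs →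
  (∀ α → ∑ xs (λ x → σ x ℤ.* row (classify 5 α) α x) ≡ 0ℤ) → 2 ^ growth p 0 ≤ length xs
zero-sum-long {m} p σ σ-sign xs nonempty zero-rows = from-start ∣ Y (firstWord p) ∣ refl
  where
  open Transform xs σ
  open ≤-Reasoning
  open Grown (grow p 0 0 Y Y ≤-refl
    (λ β → ≤-reflexive (trans (+-identityʳ _) (cong ∣_∣ (ℤ.+-inverseʳ (Y β)))))
    (λ α → sat α (classify 5 α) (zero-rows α)) z≤n)
  from-start : ∀ n → ∣ Y (firstWord p) ∣ ≡ n → 2 ^ growth p 0 ≤ length xs
  -- The whole transform would vanish; pairing with `σ` itself then makes the length 0.
  from-start zero eq = ⊥-elim (1+n≰n (≤-trans nonempty (≤-reflexive (ℤ.+-injective length≡0))))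
    where
    Y≡0 : ∀ β → Y β ≡ 0ℤ
    Y≡0 β = ℤ.∣i∣≡0⇒i≡0 (n≤0⇒n≡0 (≤-trans (offOnes≤ β) (≤-reflexive (vanishes eq))))
    length≡0 : + length xs ≡ 0ℤ
    length≡0 = trans (sym (∑-1 xs)) (trans (∑-cong xs (λ x → sym (sign-square (σ-sign x))))
      (χ-spanning xs σ (λ x → x) Y≡0 σ))
  from-start (suc n) eq = begin
    2 ^ growth p 0                        ≤⟨ m≤m*n (2 ^ growth p 0) (suc n) ⟩
    2 ^ growth p 0 * suc n                ≡⟨ cong (2 ^ growth p 0 *_) (sym eq) ⟩
    2 ^ growth p 0 * ∣ Y (firstWord p) ∣  ≤⟨ large ⟩
    ∣ Y (ones m) ∣                        ≤⟨ ∣∑∣≤length xs (λ x → σ x ℤ.* χ (ones m) x) (λ x → sign-abs (sign-* (σ-sign x) (χ-sign (ones m) x))) ⟩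
    length xs                             ∎

-- Integral null vectors and minimal families

Nonzero : ∀ {n} → (Fin n → ℤ) → Set
Nonzero z = ∃ λ j → z j ≢ 0ℤ

sum-0 : ∀ {n} {f : Fin n → ℤ} → (∀ j → f j ≡ 0ℤ) → sum f ≡ 0ℤ
sum-0 {n} eq = trans (sum-cong-≗ eq) (sum-replicate-zero n)

-- Fraction-free elimination: a zero first row is dropped together with a column, and otherwise a
-- nonzero entry `p` clears its column, a null vector of the reduced matrix being lifted after
-- scaling by `p`.
null-vector : ∀ k (A : Fin k → Fin (suc k) → ℤ) →
  ∃ λ z → Nonzero z × (∀ i → sum (λ j → z j ℤ.* A i j) ≡ 0ℤ)
null-vector zero    A = (λ _ → 1ℤ) , (zero , λ ()) , λ ()
null-vector (suc k) A with any? (λ j → ¬? (A zero j ℤ.≟ 0ℤ))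
... | no none = z , (suc j , z≢0) , rows
  where
  IH = null-vector k (λ i j → A (suc i) (suc j))
  z : Fin (suc (suc k)) → ℤ
  z zero    = 0ℤ
  z (suc j) = proj₁ IH j
  j = proj₁ (proj₁ (proj₂ IH))
  z≢0 = proj₂ (proj₁ (proj₂ IH))
  A₀≡0 : ∀ j → A zero j ≡ 0ℤ
  A₀≡0 j = decidable-stable (A zero j ℤ.≟ 0ℤ) (λ ne → none (j , ne))
  rows : ∀ i → sum (λ j → z j ℤ.* A i j) ≡ 0ℤ
  rows zero    = sum-0 (λ j → trans (cong (z j ℤ.*_) (A₀≡0 j)) (ℤ.*-zeroʳ (z j)))
  rows (suc i) = trans (ℤ.+-identityˡ _) (proj₂ (proj₂ IH) i)
... | yes (j₀ , p≢0) = z , (punchIn j₀ j , nonzero) , rows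
  where
  p = A zero j₀
  reduced : (Fin (suc (suc k)) → ℤ) → Fin (suc k) → ℤ
  reduced r j = p ℤ.* r (punchIn j₀ j) ℤ.- A zero (punchIn j₀ j) ℤ.* r j₀
  IH = null-vector k (λ i → reduced (A (suc i)))
  w = proj₁ IH
  -- The value at `j₀` that makes the first row vanish, since the other coordinates are `p` times
  -- `w`.
  v = ℤ.- sum (λ j → w j ℤ.* A zero (punchIn j₀ j))
  z = insertAt (λ j → p ℤ.* w j) j₀ v
  j = proj₁ (proj₁ (proj₂ IH))
  z-punchIn : ∀ j → z (punchIn j₀ j) ≡ p ℤ.* w j
  z-punchIn = insertAt-punchIn (λ j → p ℤ.* w j) j₀ v
  nonzero : z (punchIn j₀ j) ≢ 0ℤ
  nonzero eq with ℤ.i*j≡0⇒i≡0∨j≡0 p (trans (sym (z-punchIn j)) eq)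
  ... | inj₁ p≡0 = p≢0 p≡0
  ... | inj₂ w≡0 = proj₂ (proj₁ (proj₂ IH)) w≡0
  reduce : ∀ r → sum (λ j → z j ℤ.* r j) ≡ sum (λ j → w j ℤ.* reduced r j)
  reduce r = begin
    sum (λ j → z j ℤ.* r j)
      ≡⟨ sum-remove {i = j₀} (λ j → z j ℤ.* r j) ⟩
    z j₀ ℤ.* r j₀ ℤ.+ sum (λ j → z (punchIn j₀ j) ℤ.* r (punchIn j₀ j))
      ≡⟨ cong₂ ℤ._+_ (cong (ℤ._* r j₀) (insertAt-lookup (λ j → p ℤ.* w j) j₀ v))
           (sum-cong-≗ (λ j → cong (ℤ._* r (punchIn j₀ j)) (z-punchIn j))) ⟩
    v ℤ.* r j₀ ℤ.+ S₂
      ≡⟨ cong (ℤ._+ S₂) (neg-out (sum a) (r j₀)) ⟩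
    sum a ℤ.* (ℤ.- r j₀) ℤ.+ S₂
      ≡⟨ cong (ℤ._+ S₂) (*-distribʳ-sum (ℤ.- r j₀) a) ⟩
    sum (λ j → a j ℤ.* (ℤ.- r j₀)) ℤ.+ S₂
      ≡⟨ sym (∑-distrib-+ (λ j → a j ℤ.* (ℤ.- r j₀)) (λ j → p ℤ.* w j ℤ.* r (punchIn j₀ j))) ⟩
    sum (λ j → a j ℤ.* (ℤ.- r j₀) ℤ.+ p ℤ.* w j ℤ.* r (punchIn j₀ j))
      ≡⟨ sum-cong-≗ (λ j → collect (w j) (A zero (punchIn j₀ j)) (r j₀) p (r (punchIn j₀ j))) ⟩
    sum (λ j → w j ℤ.* reduced r j) ∎
    where
    open ≡-Reasoning
    a : Fin (suc k) → ℤ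
    a j = w j ℤ.* A zero (punchIn j₀ j)
    S₂ = sum (λ j → p ℤ.* w j ℤ.* r (punchIn j₀ j))
    neg-out : ∀ s r → (ℤ.- s) ℤ.* r ≡ s ℤ.* (ℤ.- r)
    neg-out = ℤ-Ring.solve-∀
    collect : ∀ w a r p q → w ℤ.* a ℤ.* (ℤ.- r) ℤ.+ p ℤ.* w ℤ.* q ≡ w ℤ.* (p ℤ.* q ℤ.- a ℤ.* r)
    collect = ℤ-Ring.solve-∀
  rows : ∀ i → sum (λ j → z j ℤ.* A i j) ≡ 0ℤ
  rows zero    = trans (reduce (A zero)) (sum-0 (λ j → vanish (w j) p (A zero (punchIn j₀ j))))
    where
    vanish : ∀ w p a → w ℤ.* (p ℤ.* a ℤ.- a ℤ.* p) ≡ 0ℤ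
    vanish = ℤ-Ring.solve-∀
  rows (suc i) = trans (reduce (A (suc i))) (proj₂ (proj₂ IH) i)

null-vector-except : ∀ {n} (s : Fin n) (A : Fin n → Fin n → ℤ) →
  ∃ λ z → Nonzero z × (∀ i → i ≢ s → sum (λ j → z j ℤ.* A i j) ≡ 0ℤ)
null-vector-except {suc k} s A with null-vector k (λ i → A (punchIn s i))
... | z , nz , rows = z , nz , λ i i≢s → subst (λ i → sum (λ j → z j ℤ.* A i j) ≡ 0ℤ)
  (punchIn-punchOut (i≢s ∘ sym)) (rows (punchOut (i≢s ∘ sym)))

module _ {A : Set} where
  ∑-++ : ∀ (xs ys : List A) F → ∑ (xs ++ ys) F ≡ ∑ xs F ℤ.+ ∑ ys F
  ∑-++ []       ys F = sym (ℤ.+-identityˡ _)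
  ∑-++ (x ∷ xs) ys F = trans (cong (ℤ._+_ (F x)) (∑-++ xs ys F)) (sym (ℤ.+-assoc (F x) _ _))

  ∑-replicate : ∀ n (x : A) F → ∑ (List.replicate n x) F ≡ + n ℤ.* F x
  ∑-replicate zero    x F = refl
  ∑-replicate (suc n) x F = trans (cong (ℤ._+_ (F x)) (∑-replicate n x F)) (sym (ℤ.suc-* (+ n) (F x)))

  repeated : ∀ {n} → (Fin n → A) → (Fin n → ℕ) → List A
  repeated {zero}  x c = []
  repeated {suc n} x c = List.replicate (c zero) (x zero) ++ repeated (x ∘ suc) (c ∘ suc)

  ∑-repeated : ∀ {n} (x : Fin n → A) c F → ∑ (repeated x c) F ≡ sum (λ j → + c j ℤ.* F (x j))
  ∑-repeated {zero}  x c F = refl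
  ∑-repeated {suc n} x c F = trans (∑-++ (List.replicate (c zero) (x zero)) _ F)
    (cong₂ ℤ._+_ (∑-replicate (c zero) (x zero) F) (∑-repeated (x ∘ suc) (c ∘ suc) F))

  multiplicity≤length : ∀ {n} (x : Fin n → A) c j → c j ≤ length (repeated x c)
  multiplicity≤length {suc n} x c zero = begin
    c zero                                    ≡⟨ sym (length-replicate (c zero)) ⟩
    length (List.replicate (c zero) (x zero)) ≤⟨ m≤m+n _ _ ⟩
    length (List.replicate (c zero) (x zero)) + length (repeated (x ∘ suc) (c ∘ suc))
                                              ≡⟨ sym (length-++ (List.replicate (c zero) (x zero))) ⟩
    length (repeated x c)                     ∎
    where open ≤-Reasoning
  multiplicity≤length {suc n} x c (suc j) = begin
    c (suc j)                                 ≤⟨ multiplicity≤length (x ∘ suc) (c ∘ suc) j ⟩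
    length (repeated (x ∘ suc) (c ∘ suc))     ≤⟨ m≤n+m _ _ ⟩
    length (List.replicate (c zero) (x zero)) + length (repeated (x ∘ suc) (c ∘ suc))
                                              ≡⟨ sym (length-++ (List.replicate (c zero) (x zero))) ⟩
    length (repeated x c)                     ∎
    where open ≤-Reasoning

  select : (xs : List A) → Subset (length xs) → List A
  select []       []          = []
  select (x ∷ xs) (true  ∷ S) = x ∷ select xs S
  select (x ∷ xs) (false ∷ S) = select xs S

  length-select : ∀ (xs : List A) S → length (select xs S) ≡ ∣ S ∣ₛ
  length-select []       []          = refl
  length-select (x ∷ xs) (true  ∷ S) = cong suc (length-select xs S)
  length-select (x ∷ xs) (false ∷ S) = length-select xs S

  Minimal : (List A → Set) → List A → Set
  Minimal P xs = 1 ≤ length xs × P xs × (∀ S → 1 ≤ ∣ S ∣ₛ → ∣ S ∣ₛ < length xs → ¬ P (select xs S))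

  -- While a proper nonempty selection satisfies `P`, pass to it; the length decreases.
  minimal-selection : {P : List A → Set} → Decidable P → ∀ xs → 1 ≤ length xs → P xs → ∃ (Minimal P)
  minimal-selection {P} P? xs nonempty Pxs = go xs nonempty Pxs (<-wellFounded (length xs))
    where
    go : ∀ xs → 1 ≤ length xs → P xs → Acc _<_ (length xs) → ∃ (Minimal P)
    go xs nonempty Pxs (acc rec)
      with anySubset? (λ S → (1 ≤? ∣ S ∣ₛ) ×-dec (∣ S ∣ₛ <? length xs) ×-dec P? (select xs S))
    ... | no none = xs , nonempty , Pxs , λ S 1≤ <l PS → none (S , 1≤ , <l , PS)
    ... | yes (S , 1≤ , <l , PS) = go (select xs S)
      (subst (1 ≤_) (sym (length-select xs S)) 1≤) PS
      (rec (subst (_< length xs) (sym (length-select xs S)) <l))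

-- The sign matrix and a zero-sum family

toBool : Fin 2 → Bool
toBool zero       = false
toBool (suc zero) = true

fromBool : Bool → Fin 2
fromBool false = zero
fromBool true  = suc zero

decode : ∀ m → Fin (2 ^ m) → Word m
decode zero    i = []
decode (suc m) i = toBool (proj₁ (remQuot {2} (2 ^ m) i)) ∷ decode m (proj₂ (remQuot {2} (2 ^ m) i))

encode : ∀ {m} → Word m → Fin (2 ^ m)
encode []      = zero
encode (b ∷ x) = combine (fromBool b) (encode x)

decode-encode : ∀ {m} (x : Word m) → decode m (encode x) ≡ x
decode-encode []      = refl
decode-encode {suc m} (b ∷ x) = trans
  (cong (λ q → toBool (proj₁ q) ∷ decode m (proj₂ q)) (remQuot-combine (fromBool b) (encode x)))
  (cong₂ _∷_ (to-from b) (decode-encode x))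
  where
  to-from : ∀ b → toBool (fromBool b) ≡ b
  to-from false = refl
  to-from true  = refl

encode-decode : ∀ m i → encode (decode m i) ≡ i
encode-decode zero    zero = refl
encode-decode (suc m) i = trans
  (cong₂ combine (from-to (proj₁ (remQuot {2} (2 ^ m) i))) (encode-decode m (proj₂ (remQuot {2} (2 ^ m) i))))
  (combine-remQuot {2} (2 ^ m) i)
  where
  from-to : ∀ i → fromBool (toBool i) ≡ i
  from-to zero       = refl
  from-to (suc zero) = refl

zeros : ∀ m → Word m
zeros m = replicate m false

χ-zeros : ∀ {m} (x : Word m) → χ (zeros m) x ≡ 1ℤ
χ-zeros []      = refl
χ-zeros (b ∷ x) = χ-zeros x

classify-zeros : ∀ m K → classify (suc K) (zeros m) ≡ low
classify-zeros zero    K = refl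
classify-zeros (suc m) K = extend₀-low (classify-zeros m K)

matrix : ∀ {m} → Word m → Word m → ℤ
matrix α = row (classify 5 α) α

matrix-sign : ∀ {m} (α x : Word m) → IsSign (matrix α x)
matrix-sign α = row-sign (classify 5 α) α

matrix-zeros : ∀ {m} (x : Word m) → matrix (zeros m) x ≡ 1ℤ
matrix-zeros {m} x rewrite classify-zeros m 4 = χ-zeros x

matrix-firstWord : ∀ {m} (p : Fits m 5) x → matrix (firstWord p) x ≡ 1ℤ
matrix-firstWord p x rewrite classify-firstWord p = refl

-- Indexed by `Fin` instead of words, so that `all?` decides it.
ZeroSum : ∀ {m} → (Word m → ℤ) → List (Word m) → Set
ZeroSum {m} σ xs = ∀ i → ∑ xs (λ x → σ x ℤ.* matrix (decode m i) x) ≡ 0ℤ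

-- The value at 0 is 1 to keep every column a sign vector; such a column is repeated 0 times.
signum : ℤ → ℤ
signum (+ n)    = 1ℤ
signum -[1+ n ] = -1ℤ

signum-sign : ∀ i → IsSign (signum i)
signum-sign (+ n)    = inj₁ refl
signum-sign -[1+ n ] = inj₂ refl

abs*signum : ∀ i → + ∣ i ∣ ℤ.* signum i ≡ i
abs*signum (+ n)    = ℤ.*-identityʳ (+ n)
abs*signum -[1+ n ] = trans (ℤ.*-comm (+ suc n) -1ℤ) (ℤ.-1*i≡-i (+ suc n))

zero-sum-exists : ∀ {m} → Fits m 5 →
  ∃ λ σ → (∀ x → IsSign (σ x)) × ∃ λ (xs : List (Word m)) → 1 ≤ length xs × ZeroSum σ xs
zero-sum-exists {m} p with null-vector-except (encode (firstWord p)) (λ i j → matrix (decode m i) (decode m j))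
... | z , (j , z≢0) , rows = σ , (λ x → signum-sign (z (encode x))) , xs , nonempty , zero-rows
  where
  σ : Word m → ℤ
  σ x = signum (z (encode x))
  xs = repeated (decode m) (∣_∣ ∘ z)
  nonempty : 1 ≤ length xs
  nonempty = ≤-trans (n≢0⇒n>0 (λ eq → z≢0 (ℤ.∣i∣≡0⇒i≡0 eq))) (multiplicity≤length (decode m) (∣_∣ ∘ z) j)
  ∑≡sum : ∀ α → ∑ xs (λ x → σ x ℤ.* matrix α x) ≡ sum (λ j → z j ℤ.* matrix α (decode m j))
  ∑≡sum α = trans (∑-repeated (decode m) (∣_∣ ∘ z) _) (sum-cong-≗ (λ j →
    trans (sym (ℤ.*-assoc (+ ∣ z j ∣) (σ (decode m j)) _))
      (cong (ℤ._* matrix α (decode m j))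
        (trans (cong (λ i → + ∣ z j ∣ ℤ.* signum (z i)) (encode-decode m j)) (abs*signum (z j))))))
  zeros≢first : encode (zeros m) ≢ encode (firstWord p)
  zeros≢first eq with trans (sym (classify-zeros m 4)) (trans (cong (classify 5) zeros≡first) (classify-firstWord p))
    where
    zeros≡first : zeros m ≡ firstWord p
    zeros≡first = trans (sym (decode-encode (zeros m))) (trans (cong (decode m) eq) (decode-encode (firstWord p)))
  ... | ()
  zero-rows : ZeroSum σ xs
  zero-rows i with i Fin.≟ encode (firstWord p)
  ... | no i≢    = trans (∑≡sum (decode m i)) (rows i i≢)
  -- The omitted row is constant, like that of the zero word, which is a different word and was not
  -- omitted.
  ... | yes refl = begin
    ∑ xs (λ x → σ x ℤ.* matrix (decode m (encode (firstWord p))) x)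
      ≡⟨ ∑-cong xs (λ x → cong (σ x ℤ.*_) (trans (cong (λ α → matrix α x) (decode-encode (firstWord p)))
           (trans (matrix-firstWord p x) (sym (trans (cong (λ α → matrix α x) (decode-encode (zeros m))) (matrix-zeros x)))))) ⟩
    ∑ xs (λ x → σ x ℤ.* matrix (decode m (encode (zeros m))) x)
      ≡⟨ trans (∑≡sum _) (rows (encode (zeros m)) zeros≢first) ⟩
    0ℤ ∎
    where open ≡-Reasoning

zero-sum? : ∀ {m} (σ : Word m → ℤ) → Decidable (ZeroSum σ)
zero-sum? {m} σ xs = all? (λ i → ∑ xs (λ x → σ x ℤ.* matrix (decode m i) x) ℤ.≟ 0ℤ)

-- The vectors in the cube

negative : ℤ → ℤ
negative (+ n)    = 0ℤ
negative -[1+ n ] = 1ℤ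

-- T times the entry that replaces a sign: 1 stays, and -1 becomes -1 + 1/T.
perturb : ℕ → ℤ → ℤ
perturb T ρ = + T ℤ.* ρ ℤ.+ negative ρ

module _ {A : Set} (ρ : A → ℤ) (ρ-sign : ∀ a → IsSign (ρ a)) where
  negatives : List A → ℕ
  negatives xs = ∣ ∑ xs (negative ∘ ρ) ∣

  ∑-negative : ∀ xs → ∑ xs (negative ∘ ρ) ≡ + negatives xs × negatives xs ≤ length xs
  ∑-negative [] = refl , z≤n
  ∑-negative (a ∷ xs) with ρ a | ρ-sign a | ∑-negative xs
  ... | _ | inj₁ refl | eq , le rewrite eq = refl , m≤n⇒m≤1+n le
  ... | _ | inj₂ refl | eq , le rewrite eq = refl , s≤s le

  -- A sign plus twice the indicator of its being -1 is 1. So a sum of signs has the parity of the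
  -- length.
  ∑-balance : ∀ xs → ∑ xs ρ ℤ.+ + 2 ℤ.* ∑ xs (negative ∘ ρ) ≡ + length xs
  ∑-balance xs = begin
    ∑ xs ρ ℤ.+ + 2 ℤ.* ∑ xs (negative ∘ ρ)           ≡⟨ cong (ℤ._+_ (∑ xs ρ)) (sym (∑-* xs (+ 2) (negative ∘ ρ))) ⟩
    ∑ xs ρ ℤ.+ ∑ xs (λ a → + 2 ℤ.* negative (ρ a))   ≡⟨ sym (∑-+ xs ρ _) ⟩
    ∑ xs (λ a → ρ a ℤ.+ + 2 ℤ.* negative (ρ a))      ≡⟨ ∑-cong xs (λ a → unit (ρ-sign a)) ⟩
    ∑ xs (λ _ → 1ℤ)                                  ≡⟨ ∑-1 xs ⟩
    + length xs                                      ∎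
    where
    open ≡-Reasoning
    unit : ∀ {i} → IsSign i → i ℤ.+ + 2 ℤ.* negative i ≡ 1ℤ
    unit (inj₁ refl) = refl
    unit (inj₂ refl) = refl

  ∑-length : ∀ xs → ∑ xs ρ ℤ.+ + (2 * negatives xs) ≡ + length xs
  ∑-length xs = trans (cong (ℤ._+_ (∑ xs ρ)) (trans (ℤ.pos-* 2 (negatives xs))
    (cong (+ 2 ℤ.*_) (sym (proj₁ (∑-negative xs)))))) (∑-balance xs)

  ∑-perturb : ∀ T xs → ∑ xs (perturb T ∘ ρ) ≡ + T ℤ.* ∑ xs ρ ℤ.+ + negatives xs
  ∑-perturb T xs = trans (∑-+ xs _ (negative ∘ ρ)) (cong₂ ℤ._+_ (∑-* xs (+ T) ρ) (proj₁ (∑-negative xs)))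

  perturb-zero-sum : ∀ xs → ∑ xs ρ ≡ 0ℤ → ∣ ∑ xs (perturb (length xs) ∘ ρ) ∣ ≤ length xs
  perturb-zero-sum xs eq = ≤-trans (≤-reflexive (cong ∣_∣ (trans (∑-perturb (length xs) xs)
    (trans (cong (λ s → + length xs ℤ.* s ℤ.+ + negatives xs) eq)
      (trans (cong (λ i → i ℤ.+ + negatives xs) (ℤ.*-zeroʳ (+ length xs))) (ℤ.+-identityˡ (+ negatives xs)))))))
    (proj₂ (∑-negative xs))

  -- The perturbed sum is T s + q, where s is the sum and q < T counts the negatives. If s ≥ 1, then
  -- s = 1 and q = 0, so the length would be 1; if s ≤ -2, then |T s + q| ≥ 2T - q > T.
  perturb-small : ∀ T xs → 2 ≤ length xs → length xs < T → ∣ ∑ xs (perturb T ∘ ρ) ∣ ≤ T →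
    ∑ xs ρ ≡ 0ℤ ⊎ ∑ xs ρ ≡ -1ℤ
  perturb-small T xs 2≤ <T small = by-sum (∑ xs ρ) refl
    where
    open ≤-Reasoning
    q = negatives xs
    q<T : q < T
    q<T = ≤-<-trans (proj₂ (∑-negative xs)) <T
    total : ∀ s → ∑ xs ρ ≡ s → ∣ + T ℤ.* s ℤ.+ + q ∣ ≤ T
    total s eq = subst (λ i → ∣ i ∣ ≤ T) (trans (∑-perturb T xs) (cong (λ s → + T ℤ.* s ℤ.+ + q) eq)) small
    by-sum : ∀ s → ∑ xs ρ ≡ s → ∑ xs ρ ≡ 0ℤ ⊎ ∑ xs ρ ≡ -1ℤ
    by-sum (+ zero)     eq = inj₁ eq
    by-sum -[1+ zero ]  eq = inj₂ eq
    by-sum (+ suc k)    eq = ⊥-elim (<⇒≢ 2≤ (sym length≡1))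
      where
      Tk+q≤ : T * suc k + q ≤ T
      Tk+q≤ = subst (λ i → ∣ i ℤ.+ + q ∣ ≤ T) (sym (ℤ.pos-* T (suc k))) (total (+ suc k) eq)
      T*k+q≤0 : T * k + q ≤ 0
      T*k+q≤0 = +-cancelˡ-≤ T _ _ (begin
        T + (T * k + q)   ≡⟨ sym (+-assoc T (T * k) q) ⟩
        T + T * k + q     ≡⟨ cong (_+ q) (sym (*-suc T k)) ⟩
        T * suc k + q     ≤⟨ Tk+q≤ ⟩
        T                 ≡⟨ sym (+-identityʳ T) ⟩
        T + 0             ∎)
      q≡0 : q ≡ 0
      q≡0 = m+n≡0⇒n≡0 (T * k) (n≤0⇒n≡0 T*k+q≤0)
      k≡0 : k ≡ 0
      k≡0 with m*n≡0⇒m≡0∨n≡0 T (m+n≡0⇒m≡0 (T * k) (n≤0⇒n≡0 T*k+q≤0))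
      ... | inj₁ T≡0 = ⊥-elim (<⇒≢ (≤-<-trans z≤n <T) (sym T≡0))
      ... | inj₂ eq  = eq
      length≡1 : length xs ≡ 1
      length≡1 = ℤ.+-injective (trans (sym (∑-length xs)) (trans (cong₂ (λ s q → s ℤ.+ + (2 * q)) eq q≡0)
        (cong (λ k → + suc k ℤ.+ 0ℤ) k≡0)))
    by-sum -[1+ suc k ] eq = ⊥-elim (<⇒≱ (+-monoʳ-< T q<T) (begin
      T + T                         ≤⟨ m≤m+n (T + T) (T * k) ⟩
      T + T + T * k                 ≡⟨ +-assoc T T (T * k) ⟩
      T + (T + T * k)               ≡⟨ cong (_+_ T) (sym (*-suc T k)) ⟩
      T + T * suc k                 ≡⟨ sym (*-suc T (suc k)) ⟩
      T * suc (suc k)               ≡⟨ sym (ℤ.abs-* (+ T) s) ⟩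
      ∣ + T ℤ.* s ∣                 ≡⟨ cong ∣_∣ (regroup (+ T ℤ.* s) (+ q)) ⟩
      ∣ + T ℤ.* s ℤ.+ + q ℤ.- + q ∣ ≤⟨ ℤ.∣i-j∣≤∣i∣+∣j∣ (+ T ℤ.* s ℤ.+ + q) (+ q) ⟩
      ∣ + T ℤ.* s ℤ.+ + q ∣ + q     ≤⟨ +-monoˡ-≤ q (total s eq) ⟩
      T + q                         ∎))
      where
      s = -[1+ suc k ]
      regroup : ∀ a b → a ≡ a ℤ.+ b ℤ.- b
      regroup = ℤ-Ring.solve-∀

perturb-bound : ∀ {T ρ} → 1 ≤ T → IsSign ρ → ∣ perturb T ρ ∣ ≤ T
perturb-bound {T}     _       (inj₁ refl) = ≤-reflexive (cong ∣_∣ (trans (ℤ.+-identityʳ _) (ℤ.*-identityʳ (+ T))))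
perturb-bound {suc T} (s≤s _) (inj₂ refl) = ≤-trans (≤-reflexive (cong ∣_∣ (shift (+ T))))
  (≤-trans (≤-reflexive (ℤ.∣-i∣≡∣i∣ (+ T))) (n≤1+n T))
  where
  shift : ∀ t → (1ℤ ℤ.+ t) ℤ.* -1ℤ ℤ.+ 1ℤ ≡ ℤ.- t
  shift = ℤ-Ring.solve-∀

-- The common denominator is `suc T`, as `mkℚᵘ` stores the denominator minus one.
module Scale (T : ℕ) where
  scale : ℤ → ℚ
  scale i = fromℚᵘ (mkℚᵘ i T)

  scale-0 : scale 0ℤ ≡ 0ℚ
  scale-0 = ℚ.fromℚᵘ-cong {mkℚᵘ 0ℤ T} {mkℚᵘ 0ℤ 0} (*≡* refl)

  scale-+ : ∀ i j → scale (i ℤ.+ j) ≡ scale i ℚ.+ scale j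
  scale-+ i j = ℚ.toℚᵘ-injective (begin
    toℚᵘ (scale (i ℤ.+ j))                 ≈⟨ ℚ.toℚᵘ-fromℚᵘ (mkℚᵘ (i ℤ.+ j) T) ⟩
    mkℚᵘ (i ℤ.+ j) T                       ≈⟨ *≡* (common i j (+ suc T)) ⟩
    mkℚᵘ i T ℚᵘ.+ mkℚᵘ j T                 ≈⟨ ℚᵘ.≃-sym (ℚᵘ.+-cong (ℚ.toℚᵘ-fromℚᵘ (mkℚᵘ i T)) (ℚ.toℚᵘ-fromℚᵘ (mkℚᵘ j T))) ⟩
    toℚᵘ (scale i) ℚᵘ.+ toℚᵘ (scale j)     ≈⟨ ℚᵘ.≃-sym (ℚ.toℚᵘ-homo-+ (scale i) (scale j)) ⟩
    toℚᵘ (scale i ℚ.+ scale j)             ∎)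
    where
    open import Relation.Binary.Reasoning.Setoid ℚᵘ.≃-setoid
    common : ∀ i j t → (i ℤ.+ j) ℤ.* (t ℤ.* t) ≡ (i ℤ.* t ℤ.+ j ℤ.* t) ℤ.* t
    common = ℤ-Ring.solve-∀

  abs-scale : ∀ i → toℚᵘ ℚ.∣ scale i ∣ ℚᵘ.≃ mkℚᵘ (+ ∣ i ∣) T
  abs-scale i = ℚᵘ.≃-trans (ℚ.toℚᵘ-homo-∣-∣ (scale i)) (ℚᵘ.∣-∣-cong (ℚ.toℚᵘ-fromℚᵘ (mkℚᵘ i T)))

  scale-≤ : ∀ i → ∣ i ∣ ≤ suc T → ℚ.∣ scale i ∣ ℚ.≤ 1ℚ
  scale-≤ i le = ℚ.toℚᵘ-cancel-≤ (ℚᵘ.≤-respˡ-≃ (ℚᵘ.≃-sym (abs-scale i))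
    (*≤* (subst₂ ℤ._≤_ (sym (ℤ.*-identityʳ _)) (sym (ℤ.*-identityˡ _)) (ℤ.+≤+ le))))

  scale-≤⁻¹ : ∀ i → ℚ.∣ scale i ∣ ℚ.≤ 1ℚ → ∣ i ∣ ≤ suc T
  scale-≤⁻¹ i le with ℚᵘ.≤-respˡ-≃ (abs-scale i) (ℚ.toℚᵘ-mono-≤ le)
  ... | *≤* le′ = ℤ.drop‿+≤+ (subst₂ ℤ._≤_ (ℤ.*-identityʳ _) (ℤ.*-identityˡ _) le′)

  sumFin-lookup : ∀ {A : Set} (xs : List A) (F : A → ℤ) →
    sumFin (length xs) (λ i → scale (F (List.lookup xs i))) ≡ scale (∑ xs F)
  sumFin-lookup []       F = sym scale-0
  sumFin-lookup (x ∷ xs) F = trans (cong (scale (F x) ℚ.+_) (sumFin-lookup xs F)) (sym (scale-+ (F x) _))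

  sumFin-select : ∀ {A : Set} (xs : List A) S (F : A → ℤ) →
    sumFin (length xs) (λ i → if Vec.lookup S i then scale (F (List.lookup xs i)) else 0ℚ) ≡ scale (∑ (select xs S) F)
  sumFin-select []       []          F = sym scale-0
  sumFin-select (x ∷ xs) (true  ∷ S) F = trans (cong (scale (F x) ℚ.+_) (sumFin-select xs S F)) (sym (scale-+ (F x) _))
  sumFin-select (x ∷ xs) (false ∷ S) F = trans (ℚ.+-identityˡ _) (sumFin-select xs S F)

-- The first row equals the row of zeros; perturbing it in the opposite direction forces both sums to vanish.
entryOf : ∀ {m} → Class m → ℕ → ℤ → ℤ
entryOf low       T ρ = perturb T ρ
entryOf (first _) T ρ = ℤ.- perturb T (ℤ.- ρ)
entryOf (later _) T ρ = perturb T ρ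

∑-neg : ∀ {A : Set} (xs : List A) F → ∑ xs (λ a → ℤ.- F a) ≡ ℤ.- ∑ xs F
∑-neg xs F = trans (∑-cong xs (λ a → sym (ℤ.-1*i≡-i (F a)))) (trans (∑-* xs -1ℤ F) (ℤ.-1*i≡-i (∑ xs F)))

entry-bound : ∀ {m} (c : Class m) {T ρ} → 1 ≤ T → IsSign ρ → ∣ entryOf c T ρ ∣ ≤ T
entry-bound low       1≤ s = perturb-bound 1≤ s
entry-bound (first _) {T} {ρ} 1≤ s = ≤-trans (≤-reflexive (ℤ.∣-i∣≡∣i∣ (perturb T (ℤ.- ρ)))) (perturb-bound 1≤ (sign-neg s))
entry-bound (later _) 1≤ s = perturb-bound 1≤ s

abs-∑-first : ∀ {A : Set} (xs : List A) T (ρ : A → ℤ) →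
  ∣ ∑ xs (λ a → ℤ.- perturb T (ℤ.- ρ a)) ∣ ≡ ∣ ∑ xs (λ a → perturb T (ℤ.- ρ a)) ∣
abs-∑-first xs T ρ = trans (cong ∣_∣ (∑-neg xs _)) (ℤ.∣-i∣≡∣i∣ (∑ xs (λ a → perturb T (ℤ.- ρ a))))

total-bound : ∀ {m} {A : Set} (c : Class m) (ρ : A → ℤ) → (∀ a → IsSign (ρ a)) → ∀ xs → ∑ xs ρ ≡ 0ℤ →
  ∣ ∑ xs (entryOf c (length xs) ∘ ρ) ∣ ≤ length xs
total-bound low       ρ s xs eq = perturb-zero-sum ρ s xs eq
total-bound (first _) ρ s xs eq = ≤-trans (≤-reflexive (abs-∑-first xs (length xs) ρ))
  (perturb-zero-sum (λ a → ℤ.- ρ a) (λ a → sign-neg (s a)) xs (trans (∑-neg xs ρ) (cong ℤ.-_ eq)))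
total-bound (later _) ρ s xs eq = perturb-zero-sum ρ s xs eq

-- Both sums have the parity of the length.
same-parity : ∀ {A : Set} (ρ ρ′ : A → ℤ) → (∀ a → IsSign (ρ a)) → (∀ a → IsSign (ρ′ a)) → ∀ xs →
  ∑ xs ρ ≡ 0ℤ → ∑ xs ρ′ ≡ 0ℤ ⊎ ∑ xs ρ′ ≡ -1ℤ → ∑ xs ρ′ ≡ 0ℤ
same-parity ρ ρ′ s s′ xs eq (inj₁ eq′) = eq′
same-parity ρ ρ′ s s′ xs eq (inj₂ eq′) = ⊥-elim (even≢odd q′ q (ℤ.+-injective (begin
  + (2 * q′)                        ≡⟨ shift (+ (2 * q′)) ⟩
  1ℤ ℤ.+ (-1ℤ ℤ.+ + (2 * q′))       ≡⟨ cong (λ i → 1ℤ ℤ.+ (i ℤ.+ + (2 * q′))) (sym eq′) ⟩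
  1ℤ ℤ.+ (∑ xs ρ′ ℤ.+ + (2 * q′))   ≡⟨ cong (ℤ._+_ 1ℤ) (trans (∑-length ρ′ s′ xs) (sym (∑-length ρ s xs))) ⟩
  1ℤ ℤ.+ (∑ xs ρ ℤ.+ + (2 * q))     ≡⟨ cong (λ i → 1ℤ ℤ.+ (i ℤ.+ + (2 * q))) eq ⟩
  + suc (2 * q)                     ∎)))
  where
  open ≡-Reasoning
  q  = negatives ρ s xs
  q′ = negatives ρ′ s′ xs
  shift : ∀ i → i ≡ 1ℤ ℤ.+ (-1ℤ ℤ.+ i)
  shift = ℤ-Ring.solve-∀

-- A forbidden subset sum inside the cube would give a proper nonempty zero-sum subfamily, against
-- minimality.
zero-sum-admissible : ∀ {m} → Fits m 5 → (σ : Word m → ℤ) → (∀ x → IsSign (σ x)) →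
  ∀ xs → Minimal (ZeroSum σ) xs → Admissible (2 ^ m) (length xs)
zero-sum-admissible {m} p σ σ-sign xs@(_ ∷ xs′) (nonempty , zero-sum , minimal) =
  vectors , inside-cube , total-inside , subsets-outside
  where
  t = length xs
  open Scale (length xs′)
  ρ : Word m → Word m → ℤ
  ρ α x = σ x ℤ.* matrix α x
  ρ-sign : ∀ α x → IsSign (ρ α x)
  ρ-sign α x = sign-* (σ-sign x) (matrix-sign α x)
  numerator : Word m → Word m → ℤ
  numerator α x = entryOf (classify 5 α) t (ρ α x)
  vectors : Fin t → Fin (2 ^ m) → ℚ
  vectors i j = scale (numerator (decode m j) (List.lookup xs i))
  inside-cube : ∀ i → InCube (2 ^ m) (vectors i)
  inside-cube i j = scale-≤ (numerator α (List.lookup xs i)) (entry-bound (classify 5 α) nonempty (ρ-sign α (List.lookup xs i)))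
    where α = decode m j
  total-inside : InCube (2 ^ m) (totalSum vectors)
  total-inside j = subst (λ r → ℚ.∣ r ∣ ℚ.≤ 1ℚ) (sym (sumFin-lookup xs (numerator α)))
    (scale-≤ (∑ xs (numerator α)) (total-bound (classify 5 α) (ρ α) (ρ-sign α) xs (zero-sum j)))
    where α = decode m j
  subsets-outside : ∀ S → 2 ≤ ∣ S ∣ₛ → ∣ S ∣ₛ < t → ¬ InCube (2 ^ m) (subsetSum vectors S)
  subsets-outside S 2≤ <t inside = minimal S (≤-trans (n≤1+n 1) 2≤) <t (λ j → vanish (decode m j))
    where
    ys = select xs S
    2≤length : 2 ≤ length ys
    2≤length = subst (2 ≤_) (sym (length-select xs S)) 2≤
    length<t : length ys < t
    length<t = subst (_< t) (sym (length-select xs S)) <t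
    small : ∀ α → ∣ ∑ ys (numerator α) ∣ ≤ t
    small α = subst (λ α → ∣ ∑ ys (numerator α) ∣ ≤ t) (decode-encode α)
      (scale-≤⁻¹ (∑ ys (numerator (decode m (encode α)))) (subst (λ r → ℚ.∣ r ∣ ℚ.≤ 1ℚ) (sumFin-select xs S (numerator (decode m (encode α)))) (inside (encode α))))
    ρ-const : ∀ α → (∀ x → matrix α x ≡ 1ℤ) → ∀ x → ρ α x ≡ σ x
    ρ-const α eq x = trans (cong (σ x ℤ.*_) (eq x)) (ℤ.*-identityʳ (σ x))
    from-zeros : ∑ ys σ ≡ 0ℤ ⊎ ∑ ys σ ≡ -1ℤ
    from-zeros = perturb-small σ σ-sign t ys 2≤length length<t
      (subst (λ i → ∣ i ∣ ≤ t) (∑-cong ys eq) (small (zeros m)))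
      where
      eq : ∀ x → numerator (zeros m) x ≡ perturb t (σ x)
      eq x = trans (cong (λ c → entryOf c t (ρ (zeros m) x)) (classify-zeros m 4))
        (cong (perturb t) (ρ-const (zeros m) matrix-zeros x))
    from-first : ∑ ys (λ x → ℤ.- σ x) ≡ 0ℤ ⊎ ∑ ys (λ x → ℤ.- σ x) ≡ -1ℤ
    from-first = perturb-small (λ x → ℤ.- σ x) (λ x → sign-neg (σ-sign x)) t ys 2≤length length<t
      (subst (_≤ t) (trans (cong ∣_∣ (∑-cong ys eq)) (abs-∑-first ys t σ)) (small (firstWord p)))
      where
      eq : ∀ x → numerator (firstWord p) x ≡ ℤ.- perturb t (ℤ.- σ x)
      eq x = trans (cong (λ c → entryOf c t (ρ (firstWord p) x)) (classify-firstWord p))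
        (cong (λ i → ℤ.- perturb t (ℤ.- i)) (ρ-const (firstWord p) (matrix-firstWord p) x))
    σ-zero : ∑ ys σ ≡ 0ℤ
    -- The two constant rows put both the sum and its negative in {0, -1}.
    σ-zero with from-zeros | from-first
    ... | inj₁ eq | _       = eq
    ... | inj₂ eq | inj₁ eq′ with trans (sym eq′) (trans (∑-neg ys σ) (cong ℤ.-_ eq))
    ...   | ()
    σ-zero | inj₂ eq | inj₂ eq′ with trans (sym eq′) (trans (∑-neg ys σ) (cong ℤ.-_ eq))
    ...   | ()
    signs : ∀ c α x → IsSign (σ x ℤ.* row c α x)
    signs c α x = sign-* (σ-sign x) (row-sign c α x)
    -- As `σ` sums to 0, the size is even, which excludes -1 in every other row.
    balanced : ∀ ρ′ → (∀ x → IsSign (ρ′ x)) → ∣ ∑ ys (perturb t ∘ ρ′) ∣ ≤ t → ∑ ys ρ′ ≡ 0ℤ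
    balanced ρ′ s le = same-parity σ ρ′ σ-sign s ys σ-zero (perturb-small ρ′ s t ys 2≤length length<t le)
    vanish : ∀ α → ∑ ys (ρ α) ≡ 0ℤ
    vanish α with classify 5 α | small α
    ... | low      | le = balanced (λ x → σ x ℤ.* row low α x) (signs low α) le
    ... | first _  | le = trans (∑-cong ys (λ x → ℤ.*-identityʳ (σ x))) σ-zero
    ... | later ts | le = balanced (λ x → σ x ℤ.* row (later ts) α x) (signs (later ts) α) le

-- Numerical bound and conclusion

zero-admissible : ∀ d → Admissible d 1
zero-admissible d = (λ _ _ → 0ℚ) , (λ i j → 0≤1) , (λ j → 0≤1) ,
  -- No subset has 2 ≤ |S| < 1.
  λ S 2≤ <1 _ → <⇒≱ (<-trans <1 (n<1+n 1)) 2≤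
  where
  0≤1 : 0ℚ ℚ.≤ 1ℚ
  0≤1 = ℚ.nonNegative⁻¹ 1ℚ

-- With N = 2^m, `growth-bound` for the empty prefix and K = 5 gives m N ≤ 2e + 10 N, and 1024 =
-- 2^10 absorbs the last term.
long-enough : ∀ {m} (p : Fits m 5) t → 2 ^ growth p 0 ≤ t →
  (1 * 2 ^ m) ^ (2 ^ m) ≤ t * t * 1024 ^ (2 ^ m)
long-enough {m} p t le = begin
  (1 * 2 ^ m) ^ N                 ≡⟨ cong (_^ N) (*-identityˡ (2 ^ m)) ⟩
  (2 ^ m) ^ N                     ≡⟨ ^-*-assoc 2 m N ⟩
  2 ^ (m * N)                     ≤⟨ ^-monoʳ-≤ 2 exponents ⟩
  2 ^ (e + e + 10 * N)            ≡⟨ ^-distribˡ-+-* 2 (e + e) (10 * N) ⟩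
  2 ^ (e + e) * 2 ^ (10 * N)      ≡⟨ cong₂ _*_ (^-distribˡ-+-* 2 e e) (sym (^-*-assoc 2 10 N)) ⟩
  2 ^ e * 2 ^ e * 1024 ^ N        ≤⟨ *-monoˡ-≤ (1024 ^ N) (*-mono-≤ le le) ⟩
  t * t * 1024 ^ N                ∎
  where
  open ≤-Reasoning
  N = 2 ^ m
  e = growth p 0
  regroup : ∀ e n → 2 * e + 10 + 10 * n ≡ e + e + 10 * n + 10
  regroup = ℕ-Ring.solve-∀
  exponents : m * N ≤ e + e + 10 * N
  exponents = +-cancelʳ-≤ 10 _ _ (≤-trans (growth-bound p 0 ≤-refl (inj₂ ≤-refl)) (≤-reflexive (regroup e N)))

-- With c = a/b and d = 2^k, the inequality is t ≥ (cd)^(d/2), squared and cleared of denominators.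
theorem2 : Σ ℕ λ a → Σ ℕ λ b → 0 < a × 0 < b ×
    ((k : ℕ) → Σ ℕ λ t → Admissible (2 ^ k) t ×
    (a * 2 ^ k) ^ (2 ^ k) ≤ t * t * b ^ (2 ^ k))
theorem2 = 1 , 1024 , s≤s z≤n , s≤s z≤n , bound
  where
  open ≤-Reasoning
  bound : ∀ k → Σ ℕ λ t → Admissible (2 ^ k) t × (1 * 2 ^ k) ^ (2 ^ k) ≤ t * t * 1024 ^ (2 ^ k)
  bound k with 5 ≤? k
  ... | no 5≰k = 1 , zero-admissible (2 ^ k) , (begin
    (1 * 2 ^ k) ^ (2 ^ k)      ≡⟨ cong (_^ (2 ^ k)) (*-identityˡ (2 ^ k)) ⟩
    -- For k < 5 the base 2^k is below 1024, so t = 1 suffices.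
    (2 ^ k) ^ (2 ^ k)          ≤⟨ ^-monoˡ-≤ (2 ^ k) (^-monoʳ-≤ 2 {k} {10} (≤-trans (<⇒≤ (≰⇒> 5≰k)) (m≤m+n 5 5))) ⟩
    1024 ^ (2 ^ k)             ≡⟨ sym (*-identityˡ (1024 ^ (2 ^ k))) ⟩
    1 * 1 * 1024 ^ (2 ^ k)     ∎)
  ... | yes 5≤k with zero-sum-exists (≤⇒fits 5≤k)
  ...   | σ , σ-sign , xs , nonempty , zero-sum with minimal-selection (zero-sum? σ) xs nonempty zero-sum
  ...     | ys , minimal@(nonempty′ , zero-sum′ , _) =
    length ys , zero-sum-admissible p σ σ-sign ys minimal , long-enough p (length ys)
      (zero-sum-long p σ σ-sign ys nonempty′ λ α → subst (λ α → ∑ ys (λ x → σ x ℤ.* matrix α x) ≡ 0ℤ)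
        (decode-encode α) (zero-sum′ (encode α)))
    where p = ≤⇒fits 5≤k
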